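{- For an effective space $(X,\xi)$ the following are equivalent: (1) $(X,\xi)$ is an effective quasi-Polish space; (2) $(X,\xi)$ is computably homeomorphic to the space of non-compact elements of a computable algebraic domain; (3) $(X,\xi)$ is computably homeomorphic to the space of non-compact elements of a computable domain.
   Context: An effective space is a pair $(X,\xi)$ with $X$ a countably based $T_0$ space and $\xi:\omega\to P(X)$ a numbering of a base such that $\xi(i)\cap\xi(j)=\bigcup\xi(A_{ij})$ for a uniformly c.e. family $(A_{ij})$; subspaces get the induced numbering. Computable maps: preimages of basic opens are uniformly c.e. unions of basic opens; computable homeomorphism: homeomorphism computable in both directions. $(X,\xi)$ is effective quasi-Polish if it is computably homeomorphic to a $\Pi^0_2$-subspace (effective Borel hierarchy) of the Scott domain $P\omega$. For a $T_0$ space $Y$ with specialization order $\leq_Y$, $x\ll_Y y$ means $y$ is in the interior of $\uparrow x$; $x$ is compact iff $x\ll_Y x$. An $\omega$-continuous domain is a space $Y$, directed complete under $\leq_Y$, with a countable set $B$ such that the sets $\{y\mid b\ll_Y y\}$, $b\in B$, form a base and every $y$ is the directed supremum of $\{b\in B\mid b\ll_Y y\}$. A computable domain is a pair $(Y,b)$ with $Y$ an $\omega$-continuous domain and $b:\omega\to Y$ a numbering of such a domain base such that $b_i\ll_Y b_j$ is computable; its effective structure has basic open sets $\{y\mid b_i\ll_Y y\}$. A computable algebraic domain is a pair $(Y,c)$ with $Y$ an $\omega$-algebraic domain (directed complete, the sets $\uparrow c$ for compact $c$ forming a base, countably many compact elements) and $c$ a numbering of its compact elements with $c_i\leq_Y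 c_j$ computable; its basic open sets are $\uparrow c_i$.
   Formalization: Computable (algebraic) domains are additionally required to carry the Scott topology, without which non-compact elements need not be quasi-Polish; domains range over one universe large enough to contain, up to isomorphism, every computable domain. -}

module Defs where

open import Level using (Level; _⊔_; 0ℓ) renaming (suc to lsuc)
open import Data.Empty using (⊥-elim)
open import Data.Fin using (Fin)
open import Data.Nat using (ℕ; zero; suc; _+_; _*_; _<_; _≤_; z≤n; s≤s; ⌊_/2⌋)
open import Data.Nat.DivMod using (_%_; m*n%n≡0; [m+kn]%n≡m%n)
open import Data.Nat.Properties using (≤-trans; ⌊n/2⌋≤n; m≤m+n; m≤n+m; _≟_)
open import Data.Product using (Σ; Σ-syntax; ∃; ∃-syntax; _×_; _,_; proj₁; proj₂)
open import Data.Sum using (_⊎_; inj₁; inj₂; [_,_])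
open import Data.Unit.Polymorphic using (⊤; tt)
open import Data.Vec using (Vec; []; _∷_; lookup)
open import Data.Vec.Relation.Binary.Pointwise.Inductive using (Pointwise)
open import Function using (_∘_; _⇔_)
open import Function.Bundles using (Inverse)
open import Relation.Binary using (Rel; Setoid; _Respects_)
import Relation.Binary.Construct.On as On
open import Relation.Binary.PropositionalEquality using (_≡_; refl; sym; trans; cong)
open import Relation.Nullary using (¬_; Dec; yes; no)
open import Relation.Unary using (Pred; _∈_; _⊆_; _≐_; _∩_; _∪_; ⋃; ∁)
open import Relation.Unary.Properties using (≐-refl)
open import Relation.Unary.Relation.Binary.Equality using (≐-setoid)

private
  variable
    a c c′ d ℓ ℓ′ p r r′ : Level
    n m : ℕ

-- Codes of partial recursive functions: prec recurses on, and mu searches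
-- for, the first argument.

data Rec : ℕ → Set where
  zer  : Rec n
  succ : Rec 1
  proj : Fin n → Rec n
  comp : Rec m → Vec (Rec n) m → Rec n
  prec : Rec n → Rec (suc (suc n)) → Rec (suc n)
  mu   : Rec (suc n) → Rec n

infix 4 _[_]⇓_

data _[_]⇓_ : Rec n → Vec ℕ n → ℕ → Set where
  zer⇓  : {xs : Vec ℕ n} → zer [ xs ]⇓ 0
  succ⇓ : ∀ {x} → succ [ x ∷ [] ]⇓ suc x
  proj⇓ : {i : Fin n} {xs : Vec ℕ n} → proj i [ xs ]⇓ lookup xs i
  comp⇓ : {f : Rec m} {gs : Vec (Rec n) m} {xs : Vec ℕ n} {ys : Vec ℕ m} {z : ℕ} →
          Pointwise (λ g y → g [ xs ]⇓ y) gs ys → f [ ys ]⇓ z →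
          comp f gs [ xs ]⇓ z
  prec-zero⇓ : {f : Rec n} {g : Rec (suc (suc n))} {xs : Vec ℕ n} {z : ℕ} →
          f [ xs ]⇓ z → prec f g [ 0 ∷ xs ]⇓ z
  prec-suc⇓ : {f : Rec n} {g : Rec (suc (suc n))} {xs : Vec ℕ n} {k y z : ℕ} →
          prec f g [ k ∷ xs ]⇓ y → g [ k ∷ y ∷ xs ]⇓ z →
          prec f g [ suc k ∷ xs ]⇓ z
  mu⇓   : {f : Rec (suc n)} {xs : Vec ℕ n} {k : ℕ} →
          f [ k ∷ xs ]⇓ 0 →
          (∀ {j} → j < k → ∃[ y ] f [ j ∷ xs ]⇓ suc y) →
          mu f [ xs ]⇓ k

Computable : (Vec ℕ n → ℕ) → Set
Computable f = ∃[ e ] (∀ xs → e [ xs ]⇓ f xs)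

ComputableRel : Pred (Vec ℕ n) a → Set a
ComputableRel R = ∃[ χ ] Computable χ × (∀ xs → R xs ⇔ χ xs ≡ 0)

-- Computably enumerable sets as Σ⁰₁ sets, the projections of computable ones.

CE : Pred (Vec ℕ n) a → Set (lsuc 0ℓ ⊔ a)
CE {n} A = Σ[ R ∈ Pred (Vec ℕ (suc n)) 0ℓ ]
  ComputableRel R × (∀ xs → A xs ⇔ (∃[ s ] R (s ∷ xs)))

rel₂ : (ℕ → ℕ → Set a) → Pred (Vec ℕ 2) a
rel₂ R (i ∷ j ∷ []) = R i j

rel₃ : (ℕ → ℕ → ℕ → Set a) → Pred (Vec ℕ 3) a
rel₃ R (i ∷ j ∷ k ∷ []) = R i j k

-- Closure under unions indexed by types of level ℓ is no restriction here:
-- with a countable base and excluded middle, every union of open sets is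
-- such a union.

record TopologicalSpace c ℓ : Set (lsuc (c ⊔ lsuc ℓ)) where
  field
    setoid : Setoid c ℓ
  open Setoid setoid public using (Carrier; _≈_)
  field
    Open     : Pred Carrier ℓ → Set (c ⊔ lsuc ℓ)
    resp-≈   : ∀ {U} → Open U → U Respects _≈_
    resp-≐   : ∀ {U V} → U ≐ V → Open U → Open V
    whole    : Open (λ _ → ⊤)
    ∩-open   : ∀ {U V} → Open U → Open V → Open (U ∩ V)
    ⋃-open   : ∀ {I : Set ℓ} {F : I → Pred Carrier ℓ} → (∀ i → Open (F i)) → Open (⋃ I F)

  infix 4 _≤ₛ_ _≪_

  _≤ₛ_ : Rel Carrier (c ⊔ lsuc ℓ)
  x ≤ₛ y = ∀ {U} → Open U → x ∈ U → y ∈ U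

  IsT₀ : Set (c ⊔ lsuc ℓ)
  IsT₀ = ∀ {x y} → x ≤ₛ y → y ≤ₛ x → x ≈ y

  Interior : Pred Carrier a → Pred Carrier (c ⊔ lsuc ℓ ⊔ a)
  Interior A x = ∃[ U ] Open U × x ∈ U × U ⊆ A

  _≪_ : Rel Carrier (c ⊔ lsuc ℓ)
  x ≪ y = y ∈ Interior (x ≤ₛ_)

  Compact : Pred Carrier (c ⊔ lsuc ℓ)
  Compact x = x ≪ x

  Directed : Pred Carrier d → Set (c ⊔ lsuc ℓ ⊔ d)
  Directed D = (∃[ x ] x ∈ D) ×
    (∀ {x y} → x ∈ D → y ∈ D → ∃[ z ] z ∈ D × x ≤ₛ z × y ≤ₛ z)

  IsSup : Pred Carrier d → Carrier → Set (c ⊔ lsuc ℓ ⊔ d)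
  IsSup D s = (∀ {x} → x ∈ D → x ≤ₛ s) ×
    (∀ {z} → (∀ {x} → x ∈ D → x ≤ₛ z) → s ≤ₛ z)

  DirectedComplete : Set (lsuc (c ⊔ lsuc ℓ))
  DirectedComplete = ∀ {D : Pred Carrier (c ⊔ lsuc ℓ)} → Directed D → ∃[ s ] IsSup D s

  ScottOpen : Pred Carrier ℓ → Set (lsuc (c ⊔ lsuc ℓ))
  ScottOpen U = (∀ {x y} → x ≤ₛ y → x ∈ U → y ∈ U) ×
    (∀ {D : Pred Carrier (c ⊔ lsuc ℓ)} {s} → Directed D → IsSup D s → s ∈ U →
     ∃[ x ] x ∈ D × x ∈ U)

  HasScottTopology : Set (lsuc (c ⊔ lsuc ℓ))
  HasScottTopology = ∀ U → Open U ⇔ ScottOpen U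

  -- The members of a base may live at a level r ≠ ℓ (as {y | b ≪ y} does),
  -- so their openness is expressed by inclusion in their interior.
  IsBase : (ℕ → Pred Carrier r) → Set (c ⊔ lsuc ℓ ⊔ r)
  IsBase ξ = (∀ i → ξ i ⊆ Interior (ξ i)) ×
    (∀ {U} → Open U → ∀ {x} → x ∈ U → ∃[ i ] x ∈ ξ i × ξ i ⊆ U)

record NumberedSpace c ℓ r : Set (lsuc (c ⊔ lsuc ℓ ⊔ r)) where
  field
    space : TopologicalSpace c ℓ
  open TopologicalSpace space public
  field
    ξ      : ℕ → Pred Carrier r
    isBase : IsBase ξ

  ⋃ξ : Pred ℕ a → Pred Carrier (r ⊔ a)
  ⋃ξ A x = ∃[ k ] k ∈ A × x ∈ ξ k

record EffectiveSpace c ℓ r : Set (lsuc (c ⊔ lsuc ℓ ⊔ r)) where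
  field
    numberedSpace : NumberedSpace c ℓ r
  open NumberedSpace numberedSpace public
  field
    isT₀      : IsT₀
    meet      : ℕ → ℕ → Pred ℕ 0ℓ
    meet-ce   : CE (rel₃ meet)
    meet-spec : ∀ i j → (ξ i ∩ ξ j) ≐ ⋃ξ (meet i j)

module _ (T : TopologicalSpace c ℓ) where
  open TopologicalSpace T

  subspace : Pred Carrier p → TopologicalSpace (c ⊔ p) ℓ
  subspace P = record
    { setoid = On.setoid {B = Σ Carrier P} setoid proj₁
    ; Open   = λ U → ∃[ V ] Open V × U ≐ (V ∘ proj₁)
    ; resp-≈ = λ { (V , oV , U⊆V , V⊆U) x≈y Ux → V⊆U (resp-≈ oV x≈y (U⊆V Ux)) }
    ; resp-≐ = λ { (U⊆U′ , U′⊆U) (V , oV , U⊆V , V⊆U) →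
                   V , oV , (λ u → U⊆V (U′⊆U u)) , (λ v → U⊆U′ (V⊆U v)) }
    ; whole  = _ , whole , ≐-refl
    ; ∩-open = λ { (V , oV , U⊆V , V⊆U) (V′ , oV′ , U⊆V′ , V′⊆U) →
                   _ , ∩-open oV oV′ ,
                   (λ (u , u′) → U⊆V u , U⊆V′ u′) , (λ (v , v′) → V⊆U v , V′⊆U v′) }
    ; ⋃-open = λ o → _ , ⋃-open (λ i → proj₁ (proj₂ (o i))) ,
                   (λ (i , u) → i , proj₁ (proj₂ (proj₂ (o i))) u) ,
                   (λ (i , v) → i , proj₂ (proj₂ (proj₂ (o i))) v)
    }

module _ (X : NumberedSpace c ℓ r) where
  open NumberedSpace X

  numberedSubspace : Pred Carrier p → NumberedSpace (c ⊔ p) ℓ r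
  numberedSubspace P = record
    { space  = subspace space P
    ; ξ      = λ i → ξ i ∘ proj₁
    ; isBase = (λ i x∈ξ → let (U , oU , x∈U , U⊆ξ) = proj₁ isBase i x∈ξ in
                  (U ∘ proj₁) , (U , oU , ≐-refl) , x∈U , U⊆ξ)
             , (λ { (V , oV , U⊆V , V⊆U) x∈U →
                  let (i , x∈ξ , ξ⊆V) = proj₂ isBase oV (U⊆V x∈U) in
                  i , x∈ξ , (λ y∈ξ → V⊆U (ξ⊆V y∈ξ)) })
    }

module _ (X : NumberedSpace c ℓ r) (Y : NumberedSpace c′ ℓ′ r′) where
  private
    module X = NumberedSpace X
    module Y = NumberedSpace Y

  IsComputableMap : (X.Carrier → Y.Carrier) → Set (lsuc 0ℓ ⊔ c ⊔ r ⊔ r′)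
  IsComputableMap f = Σ[ A ∈ (ℕ → Pred ℕ 0ℓ) ]
    CE (rel₂ A) × (∀ i → (Y.ξ i ∘ f) ≐ X.⋃ξ (A i))

infix 4 _≅_

_≅_ : NumberedSpace c ℓ r → NumberedSpace c′ ℓ′ r′ → Set _
X ≅ Y = Σ[ h ∈ Inverse (NumberedSpace.setoid X) (NumberedSpace.setoid Y) ]
  IsComputableMap X Y (Inverse.to h) × IsComputableMap Y X (Inverse.from h)

module _ (X : NumberedSpace c ℓ r) where
  open NumberedSpace X

  -- Differences of effectively open sets replace the closed sets of the
  -- metrizable case, since an open set of a T₀ space need not be a countable
  -- union of closed ones.
  Σ⁰₂ : Pred Carrier p → Set _
  Σ⁰₂ S = Σ[ A ∈ (ℕ → Pred ℕ 0ℓ) ] Σ[ B ∈ (ℕ → Pred ℕ 0ℓ) ]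
    CE (rel₂ A) × CE (rel₂ B) ×
    S ≐ (λ x → ∃[ n ] x ∈ ⋃ξ (A n) × ¬ (x ∈ ⋃ξ (B n)))

  Π⁰₂ : Pred Carrier p → Set _
  Π⁰₂ S = Σ⁰₂ (∁ S)

-- Canonical numbering of the finite sets: k ∈ D n iff the k-th binary
-- digit of n is 1.

D : ℕ → Pred ℕ 0ℓ
D n zero    = n % 2 ≡ 1
D n (suc k) = D ⌊ n /2⌋ k

D-zero : ∀ k → ¬ D 0 k
D-zero zero    ()
D-zero (suc k) = D-zero k

private
  half-even : ∀ k → ⌊ k * 2 /2⌋ ≡ k
  half-even zero    = refl
  half-even (suc k) = cong suc (half-even k)

  half-odd : ∀ k → ⌊ suc (k * 2) /2⌋ ≡ k
  half-odd zero    = refl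
  half-odd (suc k) = cong suc (half-odd k)

  D-∪-step : ∀ m n {k l} → ⌊ l /2⌋ ≡ k → D k ≐ (D ⌊ m /2⌋ ∪ D ⌊ n /2⌋) →
             (D l zero → D m zero ⊎ D n zero) → (D m zero ⊎ D n zero → D l zero) →
             D l ≐ (D m ∪ D n)
  D-∪-step m n {k} {l} refl (f , g) to from =
    (λ { {zero} → to ; {suc i} → f {i} }) ,
    (λ { {zero} → from ; {suc i} → g {i} })

  D-∪-bounded : ∀ b m n → m ≤ b → n ≤ b → ∃[ k ] D k ≐ (D m ∪ D n)
  D-∪-bounded zero .zero .zero z≤n z≤n = 0 , inj₁ , [ (λ x → x) , (λ x → x) ]
  D-∪-bounded (suc b) m n m≤ n≤ = go (m % 2 ≟ 1) (n % 2 ≟ 1)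
    where
    half≤ : ∀ {x} → x ≤ suc b → ⌊ x /2⌋ ≤ b
    half≤ z≤n = z≤n
    half≤ (s≤s {zero} _) = z≤n
    half≤ (s≤s {suc x} x≤) = ≤-trans (s≤s (⌊n/2⌋≤n x)) x≤
    ih = D-∪-bounded b ⌊ m /2⌋ ⌊ n /2⌋ (half≤ m≤) (half≤ n≤)
    k = proj₁ ih
    even≢ : ¬ D (k * 2) zero
    even≢ eq with trans (sym (m*n%n≡0 k 2)) eq
    ... | ()
    odd : D m zero ⊎ D n zero → ∃[ l ] D l ≐ (D m ∪ D n)
    odd w = suc (k * 2) ,
      D-∪-step m n (half-odd k) (proj₂ ih) (λ _ → w) (λ _ → [m+kn]%n≡m%n 1 k 2)
    go : Dec (D m zero) → Dec (D n zero) → ∃[ l ] D l ≐ (D m ∪ D n)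
    go (yes p) _       = odd (inj₁ p)
    go (no _)  (yes q) = odd (inj₂ q)
    go (no ¬p) (no ¬q) = k * 2 ,
      D-∪-step m n (half-even k) (proj₂ ih) (⊥-elim ∘ even≢) (⊥-elim ∘ [ ¬p , ¬q ])

D-∪ : ∀ m n → ∃[ k ] D k ≐ (D m ∪ D n)
D-∪ m n = D-∪-bounded (m + n) m n (m≤m+n m n) (m≤n+m n m)

-- The sets {A | D n ⊆ A} form the usual base of the Scott topology on P(ω).

Pω : NumberedSpace (lsuc 0ℓ) 0ℓ 0ℓ
Pω = record
  { space = record
    { setoid = ≐-setoid ℕ 0ℓ
    ; Open   = λ U → ∀ {A} → U A → ∃[ n ] β n A × β n ⊆ U
    ; resp-≈ = λ oU (A⊆B , _) A∈U →
                 let (n , D⊆A , β⊆U) = oU A∈U in β⊆U (λ {k} d → A⊆B (D⊆A {k} d))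
    ; resp-≐ = λ (U⊆V , V⊆U) oU A∈V →
                 let (n , D⊆A , β⊆U) = oU (V⊆U A∈V) in
                 n , (λ {k} → D⊆A {k}) , (λ b → U⊆V (β⊆U b))
    ; whole  = λ _ → 0 , (λ {k} d → ⊥-elim (D-zero k d)) , (λ _ → tt)
    ; ∩-open = λ oU oV (A∈U , A∈V) →
                 let (m , Dm⊆A , βm⊆U) = oU A∈U
                     (n , Dn⊆A , βn⊆V) = oV A∈V
                     (k , Dk⊆ , Dk⊇)   = D-∪ m n
                 in k , (λ {i} d → [ Dm⊆A {i} , Dn⊆A {i} ] (Dk⊆ {i} d)) ,
                    (λ b → βm⊆U (λ {i} d → b {i} (Dk⊇ {i} (inj₁ d))) ,
                           βn⊆V (λ {i} d → b {i} (Dk⊇ {i} (inj₂ d))))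
    ; ⋃-open = λ o (i , A∈F) →
                 let (n , D⊆A , β⊆F) = o i A∈F in
                 n , (λ {k} → D⊆A {k}) , (λ b → i , β⊆F b)
    }
  ; ξ      = β
  ; isBase = (λ n {A} A∈β → β n , (λ b → n , (λ {k} → b {k}) , (λ b′ {k} → b′ {k})) ,
                             (λ {k} → A∈β {k}) , (λ b {k} → b {k}))
           , (λ oU A∈U → oU A∈U)
  }
  where
  β : ℕ → Pred (Pred ℕ 0ℓ) 0ℓ
  β n A = D n ⊆ A

EffectiveQuasiPolish : EffectiveSpace c ℓ r → Set _
EffectiveQuasiPolish X = Σ[ S ∈ Pred (Pred ℕ 0ℓ) 0ℓ ]
  Π⁰₂ Pω S × EffectiveSpace.numberedSpace X ≅ numberedSubspace Pω S

-- Domains carry the Scott topology.  Existence of directed suprema in the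
-- specialization order does not ensure this: the topology could make a
-- supremum an isolated point.

record ComputableDomain c ℓ : Set (lsuc (lsuc (c ⊔ lsuc ℓ))) where
  field
    space : TopologicalSpace c ℓ
  open TopologicalSpace space public
  field
    isT₀             : IsT₀
    directedComplete : DirectedComplete
    scottTopology    : HasScottTopology
    b                : ℕ → Carrier
    isBase           : IsBase (λ i y → b i ≪ y)

  Approximants : Carrier → Pred Carrier (c ⊔ lsuc ℓ)
  Approximants y z = ∃[ i ] z ≈ b i × b i ≪ y

  field
    approx-directed : ∀ y → Directed (Approximants y)
    approx-sup      : ∀ y → IsSup (Approximants y) y
    ≪-computable    : ComputableRel (rel₂ (λ i j → b i ≪ b j))

  numberedSpace : NumberedSpace c ℓ (c ⊔ lsuc ℓ)
  numberedSpace = record { space = space ; ξ = λ i y → b i ≪ y ; isBase = isBase }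

  nonCompact : NumberedSpace (c ⊔ lsuc ℓ) ℓ (c ⊔ lsuc ℓ)
  nonCompact = numberedSubspace numberedSpace (∁ Compact)

record ComputableAlgebraicDomain c ℓ : Set (lsuc (lsuc (c ⊔ lsuc ℓ))) where
  field
    space : TopologicalSpace c ℓ
  open TopologicalSpace space public
  field
    isT₀             : IsT₀
    directedComplete : DirectedComplete
    scottTopology    : HasScottTopology
    κ                : ℕ → Carrier
    κ-compact        : ∀ i → Compact (κ i)
    κ-surjective     : ∀ {y} → Compact y → ∃[ i ] y ≈ κ i
    isBase           : IsBase (λ i y → κ i ≤ₛ y)
    ≤-computable     : ComputableRel (rel₂ (λ i j → κ i ≤ₛ κ j))

  numberedSpace : NumberedSpace c ℓ (c ⊔ lsuc ℓ)
  numberedSpace = record { space = space ; ξ = λ i y → κ i ≤ₛ y ; isBase = isBase }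

  nonCompact : NumberedSpace (c ⊔ lsuc ℓ) ℓ (c ⊔ lsuc ℓ)
  nonCompact = numberedSubspace numberedSpace (∁ Compact)

{-# OPTIONS --safe #-}

-- From quasi-Polish to algebraic: by excluded middle a Π⁰₂ set has the form
-- S = {I | ∀ n → I ∈ U n → I ∈ V n} with U n and V n effectively open.  The
-- compact elements are codes i of finite sets E i, each code also serving as
-- a stage of computation, and i ≺ j means that j is later than i, E i ⊆ E j,
-- and E j is seen by stage j to be in V n for each n < i such that E i is seen
-- by stage i to be in U n.  A non-principal ideal has unbounded stages, so its
-- union I lies in S; conversely, if I ∈ S then {i | E i ⊆ I} is such an ideal,
-- and it is the only one with union I.
--
-- From continuous to quasi-Polish: a non-compact y is determined by
-- I = {i | b i ≪ y}.  The sets I arising in this way are the rounded ideals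
-- without a greatest element, that is, those for which every finite set in the
-- ≪-down-closure of I is contained in I and has a ≪-upper bound k ∈ I such that
-- j ≪ k fails for some j ∈ I.  This is a Π⁰₂ condition since ≪ is decidable.

module Submission where

open import Defs
open import Level using (Level; 0ℓ) renaming (suc to lsuc)
open import Axiom.ExcludedMiddle using (ExcludedMiddle)
open import Data.Empty using (⊥-elim)
open import Data.Fin using (Fin)
open import Data.Fin.Patterns using (0F; 1F; 2F; 3F; 4F; 5F)
open import Data.Nat
  using (ℕ; zero; suc; pred; _+_; _*_; _∸_; _<_; _≤_; z≤n; s≤s; s≤s⁻¹; ⌊_/2⌋)
open import Data.Nat.DivMod using (_%_; m*n%n≡0; [m+kn]%n≡m%n)
open import Data.Nat.Properties
open import Data.Product using (Σ; Σ-syntax; ∃; ∃-syntax; _×_; _,_; proj₁; proj₂; map₁; map₂; uncurry)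
open import Data.Sum using (_⊎_; inj₁; inj₂; [_,_])
open import Data.Vec using (Vec; []; _∷_; lookup; map; allFin; tabulate)
open import Data.Vec.Properties using (map-lookup-allFin; tabulate-∘; tabulate∘lookup)
open import Data.Vec.Relation.Unary.All using (All; []; _∷_)
open import Data.Vec.Relation.Binary.Pointwise.Inductive using (Pointwise; []; _∷_)
open import Relation.Binary using (Setoid)
import Relation.Binary.Construct.On as On
open import Relation.Unary.Relation.Binary.Equality using (≐-setoid)
open import Function using (_∘_; _⇔_; mk⇔; Equivalence; Inverse)
open import Function.Construct.Composition using (inverse)
open import Relation.Binary.PropositionalEquality
  using (_≡_; _≗_; refl; sym; trans; cong; cong₂; subst)
open import Relation.Nullary using (¬_; Dec; yes; no)
open import Relation.Nullary.Decidable
  using (True; toWitness; fromWitness; decidable-stable; map′)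
open import Relation.Unary using (Pred; Decidable; _⊆_; _≐_; _∩_; _∪_; ∁)

private
  variable
    a p c c′ ℓ ℓ′ ℓ″ r r′ r″ : Level
    m n : ℕ

open Equivalence using (to; from)

-- Computable functions and relations

Computable-resp : {f g : Vec ℕ n → ℕ} → f ≗ g → Computable f → Computable g
Computable-resp f≗g (e , ev) = e , λ xs → subst (e [ xs ]⇓_) (f≗g xs) (ev xs)

lookup-computable : (i : Fin n) → Computable (λ xs → lookup xs i)
lookup-computable i = proj i , λ _ → proj⇓

zero-computable : Computable {n} (λ _ → 0)
zero-computable = zer , λ _ → zer⇓

compose-computable : {f : Vec ℕ m → ℕ} {gs : Vec (Vec ℕ n → ℕ) m} →
  Computable f → All Computable gs → Computable (λ xs → f (map (λ g → g xs) gs))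
compose-computable {n = n} (e , ev) cgs =
  comp e (codes cgs) , λ xs → comp⇓ (evals cgs xs) (ev _)
  where
  codes : ∀ {k} {gs : Vec (Vec ℕ n → ℕ) k} → All Computable gs → Vec (Rec n) k
  codes []        = []
  codes (c ∷ cs) = proj₁ c ∷ codes cs
  evals : ∀ {k} {gs : Vec (Vec ℕ n → ℕ) k} (cs : All Computable gs) xs →
          Pointwise (λ g y → g [ xs ]⇓ y) (codes cs) (map (λ g → g xs) gs)
  evals []       xs = []
  evals (c ∷ cs) xs = proj₂ c xs ∷ evals cs xs

suc-computable : {f : Vec ℕ n → ℕ} → Computable f → Computable (suc ∘ f)
suc-computable cf = compose-computable {f = λ { (x ∷ []) → suc x }}
  (succ , λ { (_ ∷ []) → succ⇓ }) (cf ∷ [])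

primrec : (Vec ℕ n → ℕ) → (Vec ℕ (suc (suc n)) → ℕ) → Vec ℕ (suc n) → ℕ
primrec f g (zero  ∷ xs) = f xs
primrec f g (suc k ∷ xs) = g (k ∷ primrec f g (k ∷ xs) ∷ xs)

primrec-computable : {f : Vec ℕ n → ℕ} {g : Vec ℕ (suc (suc n)) → ℕ} →
  Computable f → Computable g → Computable (primrec f g)
primrec-computable {f = f} {g = g} (e , ev) (e′ , ev′) = prec e e′ , go
  where
  go : ∀ xs → prec e e′ [ xs ]⇓ primrec f g xs
  go (zero  ∷ xs) = prec-zero⇓ (ev xs)
  go (suc k ∷ xs) = prec-suc⇓ (go (k ∷ xs)) (ev′ _)

+-computable : {f g : Vec ℕ n → ℕ} →
  Computable f → Computable g → Computable (λ xs → f xs + g xs)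
+-computable cf cg = compose-computable
  (Computable-resp {g = λ { (x ∷ y ∷ []) → x + y }} (λ { (x ∷ y ∷ []) → eq x y })
    (primrec-computable (lookup-computable 0F) (suc-computable (lookup-computable 1F))))
  (cf ∷ cg ∷ [])
  where
  eq : ∀ x y → primrec _ _ (x ∷ y ∷ []) ≡ x + y
  eq zero    y = refl
  eq (suc x) y = cong suc (eq x y)

pred-computable : {f : Vec ℕ n → ℕ} → Computable f → Computable (pred ∘ f)
pred-computable cf = compose-computable
  (Computable-resp {g = λ { (x ∷ []) → pred x }} (λ { (zero ∷ []) → refl ; (suc _ ∷ []) → refl })
    (primrec-computable zero-computable (lookup-computable 0F)))
  (cf ∷ [])

∸-computable : {f g : Vec ℕ n → ℕ} →
  Computable f → Computable g → Computable (λ xs → f xs ∸ g xs)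
∸-computable cf cg = compose-computable
  -- The recursion runs on the subtrahend `y`, each step applying `pred`; hence the swapped
  -- arguments.
  (Computable-resp {g = λ { (y ∷ x ∷ []) → x ∸ y }} (λ { (y ∷ x ∷ []) → eq y x })
    (primrec-computable (lookup-computable 0F) (pred-computable (lookup-computable 1F))))
  (cg ∷ cf ∷ [])
  where
  eq : ∀ y x → primrec _ _ (y ∷ x ∷ []) ≡ x ∸ y
  eq zero    x = refl
  eq (suc y) x = trans (cong pred (eq y x)) (pred[m∸n]≡m∸[1+n] x y)

parity-suc : ∀ n → 1 ∸ n % 2 ≡ suc n % 2
parity-suc zero          = refl
parity-suc (suc zero)    = refl
parity-suc (suc (suc n)) = parity-suc n

half-suc : ∀ n → ⌊ n /2⌋ + n % 2 ≡ ⌊ suc n /2⌋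
half-suc zero          = refl
half-suc (suc zero)    = refl
half-suc (suc (suc n)) = cong suc (half-suc n)

parity-computable : {f : Vec ℕ n → ℕ} → Computable f → Computable (λ xs → f xs % 2)
parity-computable cf = compose-computable
  (Computable-resp {g = λ { (x ∷ []) → x % 2 }} (λ { (x ∷ []) → eq x })
    (primrec-computable zero-computable
      (∸-computable (suc-computable zero-computable) (lookup-computable 1F))))
  (cf ∷ [])
  where
  eq : ∀ x → primrec _ _ (x ∷ []) ≡ x % 2
  eq zero    = refl
  eq (suc x) = trans (cong (1 ∸_) (eq x)) (parity-suc x)

-- Recursion with increment `x % 2`: the half grows exactly on passing an odd number.
half-computable : {f : Vec ℕ n → ℕ} → Computable f → Computable (λ xs → ⌊ f xs /2⌋)
half-computable cf = compose-computable
  (Computable-resp {g = λ { (x ∷ []) → ⌊ x /2⌋ }} (λ { (x ∷ []) → eq x })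
    (primrec-computable zero-computable
      (+-computable (lookup-computable 1F) (parity-computable (lookup-computable 0F)))))
  (cf ∷ [])
  where
  eq : ∀ x → primrec _ _ (x ∷ []) ≡ ⌊ x /2⌋
  eq zero    = refl
  eq (suc x) = trans (cong (_+ x % 2) (eq x)) (half-suc x)

ComputableRel-resp : {P : Pred (Vec ℕ n) a} {Q : Pred (Vec ℕ n) p} →
  (∀ xs → Q xs ⇔ P xs) → ComputableRel P → ComputableRel Q
ComputableRel-resp eq (χ , cχ , spec) = χ , cχ , λ xs →
  mk⇔ (to (spec xs) ∘ to (eq xs)) (from (eq xs) ∘ from (spec xs))

ComputableRel⇒Decidable : {P : Pred (Vec ℕ n) a} → ComputableRel P → Decidable P
ComputableRel⇒Decidable (χ , _ , spec) xs = map′ (from (spec xs)) (to (spec xs)) (χ xs ≟ 0)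

rename-computable : {f : Vec ℕ m → ℕ} (ρ : Vec (Fin n) m) →
  Computable f → Computable (λ xs → f (map (lookup xs) ρ))
rename-computable {n = n} {f = f} ρ cf =
  Computable-resp (λ xs → cong f (eq xs ρ)) (compose-computable cf (vars ρ))
  where
  fns : ∀ {k} → Vec (Fin n) k → Vec (Vec ℕ n → ℕ) k
  fns = map (λ i xs → lookup xs i)
  vars : ∀ {k} (ρ : Vec (Fin n) k) → All Computable (fns ρ)
  vars []      = []
  vars (i ∷ ρ) = lookup-computable i ∷ vars ρ
  eq : ∀ {k} xs (ρ : Vec (Fin n) k) → map (λ g → g xs) (fns ρ) ≡ map (lookup xs) ρ
  eq xs []      = refl
  eq xs (i ∷ ρ) = cong (lookup xs i ∷_) (eq xs ρ)

rename : {P : Pred (Vec ℕ m) a} (ρ : Vec (Fin n) m) →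
  ComputableRel P → ComputableRel (λ xs → P (map (lookup xs) ρ))
rename ρ (χ , cχ , spec) = _ , rename-computable ρ cχ , λ xs → spec _

-- Truth is the value 0, so conjunction becomes a sum of characteristic functions.
∩-computable : {P : Pred (Vec ℕ n) a} {Q : Pred (Vec ℕ n) p} →
  ComputableRel P → ComputableRel Q → ComputableRel (P ∩ Q)
∩-computable (χ , cχ , spec) (χ′ , cχ′ , spec′) = _ , +-computable cχ cχ′ , λ xs → mk⇔
  (λ (p , q) → cong₂ _+_ (to (spec xs) p) (to (spec′ xs) q))
  (λ eq → from (spec xs) (m+n≡0⇒m≡0 (χ xs) eq) , from (spec′ xs) (m+n≡0⇒n≡0 (χ xs) eq))

∁-computable : {P : Pred (Vec ℕ n) a} → ComputableRel P → ComputableRel (∁ P)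
∁-computable (χ , cχ , spec) =
  _ , ∸-computable (suc-computable zero-computable) cχ , λ xs → mk⇔
  (λ ¬p → m≤n⇒m∸n≡0 (n≢0⇒n>0 (¬p ∘ from (spec xs))))
  (λ eq p → n>0⇒n≢0 (m∸n≡0⇒m≤n eq) (to (spec xs) p))

⇒-computable : {P : Pred (Vec ℕ n) a} {Q : Pred (Vec ℕ n) p} →
  ComputableRel P → ComputableRel Q → ComputableRel (λ xs → P xs → Q xs)
⇒-computable cP cQ = ComputableRel-resp
  (λ xs → mk⇔ (λ f (p , ¬q) → ¬q (f p))
    (λ ¬pq p → decidable-stable (ComputableRel⇒Decidable cQ xs) (λ ¬q → ¬pq (p , ¬q))))
  (∁-computable (∩-computable cP (∁-computable cQ)))

∪-computable : {P : Pred (Vec ℕ n) a} {Q : Pred (Vec ℕ n) p} →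
  ComputableRel P → ComputableRel Q → ComputableRel (P ∪ Q)
∪-computable cP cQ = ComputableRel-resp
  (λ xs → mk⇔ (λ pq ¬p → [ ⊥-elim ∘ ¬p , (λ q → q) ] pq)
    (λ f → case-dec (ComputableRel⇒Decidable cP xs) f))
  (⇒-computable (∁-computable cP) cQ)
  where
  case-dec : {P : Set a} {Q : Set p} → Dec P → (¬ P → Q) → P ⊎ Q
  case-dec (yes p) f = inj₁ p
  case-dec (no ¬p) f = inj₂ (f ¬p)

≤-computable : {f g : Vec ℕ n → ℕ} →
  Computable f → Computable g → ComputableRel (λ xs → f xs ≤ g xs)
≤-computable cf cg = _ , ∸-computable cf cg , λ xs → mk⇔ m≤n⇒m∸n≡0 m∸n≡0⇒m≤n

≡-computable : {f g : Vec ℕ n → ℕ} →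
  Computable f → Computable g → ComputableRel (λ xs → f xs ≡ g xs)
≡-computable cf cg = ComputableRel-resp
  (λ xs → mk⇔ (λ eq → ≤-reflexive eq , ≤-reflexive (sym eq)) (uncurry ≤-antisym))
  (∩-computable (≤-computable cf cg) (≤-computable cg cf))

-- The sum of the characteristic function over all `k` below the bound vanishes exactly when each
-- term does.
∀<-computable : {P : Pred (Vec ℕ (suc n)) a} (i : Fin n) → ComputableRel P →
  ComputableRel (λ xs → ∀ {k} → k < lookup xs i → P (k ∷ xs))
∀<-computable {n = n} {P = P} i (χ , cχ , spec) = ComputableRel-resp
  (λ xs → mk⇔ (subst (λ ys → Bounded (lookup xs i ∷ ys)) (sym (map-lookup-allFin xs)))
              (subst (λ ys → Bounded (lookup xs i ∷ ys)) (map-lookup-allFin xs)))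
  -- The bounding variable is copied to the front, where it serves as the recursion argument.
  (rename (i ∷ allFin n) bounded)
  where
  Bounded : Pred (Vec ℕ (suc n)) _
  Bounded (y ∷ xs) = ∀ {k} → k < y → P (k ∷ xs)

  step : Vec ℕ (suc (suc n)) → ℕ
  step (k ∷ s ∷ xs) = s + χ (k ∷ xs)

  step-computable : Computable step
  step-computable = Computable-resp
    (λ { (k ∷ s ∷ xs) → cong (λ ys → s + χ (k ∷ ys))
      (trans (sym (tabulate-∘ (lookup (k ∷ s ∷ xs)) (Fin.suc ∘ Fin.suc))) (tabulate∘lookup xs)) })
    (+-computable (lookup-computable 1F)
      (rename-computable (0F ∷ tabulate (Fin.suc ∘ Fin.suc)) cχ))

  χ′ : Vec ℕ (suc n) → ℕ
  χ′ = primrec (λ _ → 0) step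

  sound : ∀ y xs → Bounded (y ∷ xs) → χ′ (y ∷ xs) ≡ 0
  sound zero    xs _ = refl
  sound (suc y) xs f = cong₂ _+_ (sound y xs (f ∘ m<n⇒m<1+n)) (to (spec _) (f ≤-refl))

  complete : ∀ y xs → χ′ (y ∷ xs) ≡ 0 → Bounded (y ∷ xs)
  complete (suc y) xs eq k< with m<1+n⇒m<n∨m≡n k<
  ... | inj₁ k<y  = complete y xs (m+n≡0⇒m≡0 (χ′ (y ∷ xs)) eq) k<y
  ... | inj₂ refl = from (spec _) (m+n≡0⇒n≡0 (χ′ (y ∷ xs)) eq)

  bounded : ComputableRel Bounded
  bounded = χ′ , primrec-computable zero-computable step-computable ,
    λ { (y ∷ xs) → mk⇔ (sound y xs) (complete y xs) }

∃<-computable : {P : Pred (Vec ℕ (suc n)) a} (i : Fin n) → ComputableRel P →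
  ComputableRel (λ xs → ∃[ k ] k < lookup xs i × P (k ∷ xs))
∃<-computable {P = P} i cP = ComputableRel-resp
  (λ xs → mk⇔ (λ (k , k< , p) f → f k< p) (search xs (lookup xs i)))
  (∁-computable (∀<-computable i (∁-computable cP)))
  where
  search : ∀ xs y → ¬ (∀ {k} → k < y → ¬ P (k ∷ xs)) → ∃[ k ] k < y × P (k ∷ xs)
  search xs zero    ¬f = ⊥-elim (¬f λ ())
  search xs (suc y) ¬f with ComputableRel⇒Decidable cP (y ∷ xs)
  ... | yes p = y , ≤-refl , p
  ... | no ¬p = map₂ (map₁ m<n⇒m<1+n) (search xs y λ f → ¬f λ k< →
    [ f , (λ { refl → ¬p }) ] (m<1+n⇒m<n∨m≡n k<))

-- The `k`-th binary digit is the parity after `k` halvings, an iteration that `shift` performs by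
-- primitive recursion.
D-computable : {f g : Vec ℕ n → ℕ} →
  Computable f → Computable g → ComputableRel (λ xs → D (f xs) (g xs))
D-computable {f = f} {g = g} cf cg = ComputableRel-resp
  (λ xs → mk⇔ (subst (λ z → z) (eq (f xs) (g xs))) (subst (λ z → z) (sym (eq (f xs) (g xs)))))
  (≡-computable {g = λ _ → 1}
    (parity-computable (compose-computable
      (primrec-computable (lookup-computable 0F) (half-computable (lookup-computable 1F)))
      (cg ∷ cf ∷ [])))
    (suc-computable zero-computable))
  where
  shift : Vec ℕ 2 → ℕ
  shift = primrec (λ xs → lookup xs 0F) (λ xs → ⌊ lookup xs 1F /2⌋)
  shift-half : ∀ k x → shift (k ∷ ⌊ x /2⌋ ∷ []) ≡ ⌊ shift (k ∷ x ∷ []) /2⌋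
  shift-half zero    x = refl
  shift-half (suc k) x = cong ⌊_/2⌋ (shift-half k x)
  eq : ∀ x k → D x k ≡ (shift (k ∷ x ∷ []) % 2 ≡ 1)
  eq x zero    = refl
  eq x (suc k) = trans (eq ⌊ x /2⌋ k) (cong (λ z → z % 2 ≡ 1) (shift-half k x))

D? : ∀ a → Decidable (D a)
D? a k = ComputableRel⇒Decidable
  (D-computable (lookup-computable 0F) (lookup-computable 1F)) (a ∷ k ∷ [])

-- A digit 1 in place `k` makes the code at least 2^k. This turns quantifiers over `D a` into
-- bounded ones.
D-bound : ∀ a {k} → D a k → k < a
D-bound zero    {k}     d = ⊥-elim (D-zero k d)
D-bound (suc a) {zero}  d = s≤s z≤n
D-bound (suc a) {suc k} d = ≤-trans (s≤s (D-bound ⌊ suc a /2⌋ {k} d)) (⌊n/2⌋<n a)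

D⊆-computable : {P : Pred (Vec ℕ (suc n)) a} (i : Fin n) → ComputableRel P →
  ComputableRel (λ xs → D (lookup xs i) ⊆ (λ k → P (k ∷ xs)))
D⊆-computable i cP = ComputableRel-resp
  (λ xs → mk⇔ (λ f {k} _ → f {k}) (λ f {k} d → f (D-bound (lookup xs i) d) d))
  (∀<-computable i
    (⇒-computable (D-computable (lookup-computable (Fin.suc i)) (lookup-computable 0F)) cP))

∃∈D-computable : {P : Pred (Vec ℕ (suc n)) a} (i : Fin n) → ComputableRel P →
  ComputableRel (λ xs → ∃[ k ] D (lookup xs i) k × P (k ∷ xs))
∃∈D-computable i cP = ComputableRel-resp
  (λ xs → mk⇔ (λ (k , d , p) → k , D-bound (lookup xs i) d , d , p) (λ (k , _ , dp) → k , dp))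
  (∃<-computable i
    (∩-computable (D-computable (lookup-computable (Fin.suc i)) (lookup-computable 0F)) cP))

Computable⇒CE : {R : ℕ → ℕ → Set} → ComputableRel (rel₂ R) → CE (rel₂ R)
Computable⇒CE cR = _ , rename (1F ∷ 2F ∷ []) cR , λ { (_ ∷ _ ∷ []) → mk⇔ (0 ,_) proj₂ }

-- The single witness that `CE` asks for is a common bound on `j` and the two given witnesses, below
-- which all three are searched.
CE-compose : {A B : ℕ → Pred ℕ 0ℓ} → CE (rel₂ A) → CE (rel₂ B) →
  CE (rel₂ (λ i k → ∃[ j ] A i j × B j k))
CE-compose (R , cR , spec) (R′ , cR′ , spec′) = _ ,
  -- In the innermost scope the variables are `t`, `s`, `j`, the bound, `i`, `k`, in this order.
  ∃<-computable 0F (∃<-computable 1F (∃<-computable 2F (∩-computable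
    (rename (1F ∷ 4F ∷ 2F ∷ []) cR) (rename (0F ∷ 2F ∷ 5F ∷ []) cR′)))) ,
  λ { (i ∷ k ∷ []) → mk⇔
    (λ (j , α , β) →
      let (s , p) = to (spec (i ∷ j ∷ [])) α
          (t , q) = to (spec′ (j ∷ k ∷ [])) β
      in suc (j + (s + t)) ,
         j , s≤s (m≤m+n j _) ,
         s , s≤s (≤-trans (m≤m+n s t) (m≤n+m _ j)) ,
         t , s≤s (≤-trans (m≤n+m t s) (m≤n+m _ j)) , p , q)
    (λ (_ , j , _ , s , _ , t , _ , p , q) →
      j , from (spec (i ∷ j ∷ [])) (s , p) , from (spec′ (j ∷ k ∷ [])) (t , q)) }

-- Finite sets

-- The code is built digit by digit: that of `P ∘ suc` is doubled, and 1 is added if `P 0` holds.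
finite : ∀ n {P : Pred ℕ a} → Decidable P → (∀ {k} → P k → k < n) → ∃[ e ] D e ≐ P
finite zero    P? P<n = 0 , (λ {k} d → ⊥-elim (D-zero k d)) , (λ p → ⊥-elim (n≮0 (P<n p)))
finite (suc n) {P} P? P<n =
  let (e , D⊆ , D⊇) = finite n (P? ∘ suc) (s≤s⁻¹ ∘ P<n)
  in cons (P? 0) e (λ {k} → D⊆ {k}) (λ {k} → D⊇ {k})
  where
  half-even : ∀ k → ⌊ k * 2 /2⌋ ≡ k
  half-even zero    = refl
  half-even (suc k) = cong suc (half-even k)
  half-odd : ∀ k → ⌊ suc (k * 2) /2⌋ ≡ k
  half-odd zero    = refl
  half-odd (suc k) = cong suc (half-odd k)
  cons : Dec (P 0) → ∀ e → D e ⊆ P ∘ suc → P ∘ suc ⊆ D e → ∃[ e ] D e ≐ P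
  cons (yes p) e D⊆ D⊇ = suc (e * 2) ,
    (λ { {zero} _ → p ; {suc k} d → D⊆ {k} (subst (λ x → D x k) (half-odd e) d) }) ,
    (λ { {zero} _ → [m+kn]%n≡m%n 1 e 2
       ; {suc k} p → subst (λ x → D x k) (sym (half-odd e)) (D⊇ {k} p) })
  cons (no ¬p) e D⊆ D⊇ = e * 2 ,
    (λ { {zero} d → ⊥-elim (1+n≢0 (trans (sym d) (m*n%n≡0 e 2)))
       ; {suc k} d → D⊆ {k} (subst (λ x → D x k) (half-even e) d) }) ,
    (λ { {zero} p → ⊥-elim (¬p p)
       ; {suc k} p → subst (λ x → D x k) (sym (half-even e)) (D⊇ {k} p) })

singleton : ∀ i → ∃[ m ] D m ≐ (_≡ i)
singleton i = finite (suc i) (_≟ i) (λ { refl → ≤-refl })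

adjoin : ∀ n k → ∃[ l ] D l ≐ (D n ∪ (_≡ k))
adjoin n k =
  let (m , m⊆ , m⊇) = singleton k
      (l , l⊆ , l⊇) = D-∪ n m
  in l , (λ {i} d → [ inj₁ , (λ d → inj₂ (m⊆ {i} d)) ] (l⊆ {i} d)) ,
         (λ {i} → [ (λ d → l⊇ {i} (inj₁ d)) , (λ eq → l⊇ {i} (inj₂ (m⊇ {i} eq))) ])

-- Every number codes a finite set E i, and every finite set has arbitrarily
-- large codes since the odd binary digits are ignored.

E : ℕ → Pred ℕ 0ℓ
E i k = D i (2 * k)

E-bound : ∀ i {k} → E i k → k < i
E-bound i {k} e = ≤-<-trans (m≤m+n k _) (D-bound i e)

E-finite : ∀ i → ∃[ a ] D a ≐ E i
E-finite i = finite i (λ k → D? i (2 * k)) (E-bound i)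

E-computable : {f g : Vec ℕ n → ℕ} →
  Computable f → Computable g → ComputableRel (λ xs → E (f xs) (g xs))
E-computable cf cg = D-computable cf (+-computable cg (+-computable cg zero-computable))

-- The code has digit 1 in the places `2 * k` with `k` in `D a`, and in the odd place `2 * s + 1`,
-- which `E` ignores but which makes the code large.
E-surjective : ∀ a s → ∃[ i ] s ≤ i × E i ≐ D a
E-surjective a s =
  let (i , P⊆ , P⊇) = finite (2 * a + suc (suc (2 * s))) P? P-bound
  in i , ≤-trans (m≤n⇒m≤1+n (m≤m+n s _)) (<⇒≤ (D-bound i (P⊇ (inj₂ refl)))) ,
     (λ {k} e → [ (λ (k′ , eq , d) → subst (D a) (sym (*-cancelˡ-≡ k k′ 2 eq)) d) ,
                  ⊥-elim ∘ even≢odd k s ] (P⊆ {2 * k} e)) ,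
     (λ {k} d → P⊇ {2 * k} (inj₁ (k , refl , d)))
  where
  P : Pred ℕ 0ℓ
  P j = (∃[ k ] j ≡ 2 * k × D a k) ⊎ j ≡ suc (2 * s)
  P-bound : ∀ {j} → P j → j < 2 * a + suc (suc (2 * s))
  P-bound (inj₁ (k , refl , d)) = <-≤-trans (*-monoʳ-< 2 (D-bound a {k} d)) (m≤m+n (2 * a) _)
  P-bound (inj₂ refl)           = m≤n+m _ (2 * a)
  P? : Decidable P
  P? j = ComputableRel⇒Decidable
    (∪-computable
      (ComputableRel-resp
        (λ xs → mk⇔ (λ (k , eq , d) → k , d , eq) (λ (k , d , eq) → k , eq , d))
        (∃∈D-computable 1F (≡-computable (lookup-computable 1F)
          (+-computable (lookup-computable 0F) (+-computable (lookup-computable 0F) zero-computable)))))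
      (≡-computable (lookup-computable 0F) (lookup-computable 2F)))
    (j ∷ a ∷ suc (2 * s) ∷ [])

-- Directedness meets finitely many demands together: an element serving all `k < n` is joined with
-- one serving `n`, and monotonicity keeps both served.
collect : {A : Set a} (_≤_ : A → A → Set p) (K : Pred A c) → ∃ K →
  (∀ {x y} → K x → K y → ∃[ z ] K z × x ≤ z × y ≤ z) →
  {P : Pred ℕ ℓ} → Decidable P →
  (Q : ℕ → Pred A ℓ′) → (∀ k {x y} → x ≤ y → Q k x → Q k y) →
  ∀ n → (∀ k → P k → ∃[ x ] K x × Q k x) →
  ∃[ x ] K x × (∀ k → k < n → P k → Q k x)
collect _≤_ K (x , Kx) join P? Q mono zero    _ = x , Kx , λ _ ()
collect {A = A} _≤_ K inh join {P} P? Q mono (suc n) f =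
  let (x , Kx , qx)        = collect _≤_ K inh join P? Q mono n f
      (y , Ky , qy)        = choose (P? n)
      (z , Kz , x≤z , y≤z) = join Kx Ky
  in z , Kz , λ k k< p →
       [ (λ k<n → mono k x≤z (qx k k<n p)) , (λ { refl → mono k y≤z (qy p) }) ]
         (m<1+n⇒m<n∨m≡n k<)
  where
  choose : Dec (P n) → ∃[ y ] K y × (P n → Q n y)
  choose (yes p) = let (y , Ky , q) = f n p in y , Ky , λ _ → q
  -- Without a demand at `n`, any element of `K` will do.
  choose (no ¬p) = let (y , Ky) = inh in y , Ky , ⊥-elim ∘ ¬p

-- Composition and construction of homeomorphisms

≅-trans : {X : NumberedSpace a ℓ r} {Y : NumberedSpace c ℓ′ r′} {Z : NumberedSpace c′ ℓ″ r″} →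
  X ≅ Y → Y ≅ Z → X ≅ Z
≅-trans {X = X} {Y} {Z} (h , ch , ch⁻¹) (k , ck , ck⁻¹) =
  inverse h k , IsComputableMap-∘ X Y Z ch ck , IsComputableMap-∘ Z Y X ck⁻¹ ch⁻¹
  where
  IsComputableMap-∘ : ∀ {a b c ℓ ℓ′ ℓ″ r r′ r″}
    (X : NumberedSpace a ℓ r) (Y : NumberedSpace b ℓ′ r′) (Z : NumberedSpace c ℓ″ r″) {f g} →
    IsComputableMap X Y f → IsComputableMap Y Z g → IsComputableMap X Z (g ∘ f)
  IsComputableMap-∘ X Y Z (A , ceA , A-spec) (B , ceB , B-spec) =
    _ , CE-compose ceB ceA , λ i →
      (λ z → let (j , Bij , y) = proj₁ (B-spec i) z
                 (k , Ajk , x) = proj₁ (A-spec j) y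
             in k , (j , Bij , Ajk) , x) ,
      (λ (k , (j , Bij , Ajk) , x) →
        proj₂ (B-spec i) (j , Bij , proj₂ (A-spec j) (k , Ajk , x)))

module _ {S : Setoid a ℓ} {T : Setoid p ℓ′} where
  private
    module S = Setoid S
    module T = Setoid T

  -- The laws in `Inverse` range over arguments related by the setoid equality; congruence reduces
  -- them to the pointwise laws.
  strictInverse : (f : S.Carrier → T.Carrier) (g : T.Carrier → S.Carrier) →
    (∀ {x y} → x S.≈ y → f x T.≈ f y) → (∀ {x y} → x T.≈ y → g x S.≈ g y) →
    (∀ y → f (g y) T.≈ y) → (∀ x → g (f x) S.≈ x) → Inverse S T
  strictInverse f g f-cong g-cong fg gf = record
    { to        = f
    ; from      = g
    ; to-cong   = f-cong
    ; from-cong = g-cong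
    ; inverse   = (λ {y} eq → T.trans (f-cong eq) (fg y)) ,
                  (λ {x} eq → S.trans (g-cong eq) (gf x))
    }

-- Consequences of excluded middle

module _ (em : ∀ {a} → ExcludedMiddle a) where

  stable : {P : Set a} → ¬ ¬ P → P
  stable = decidable-stable em

  -- Excluded middle makes every proposition equivalent to one at level 0.
  Resize : Set a → Set
  Resize P = True (em {P = P})

  resize : {P : Set a} → P → Resize P
  resize = fromWitness

  unresize : {P : Set a} → Resize P → P
  unresize = toWitness

  -- The ideal completion of a computable preorder on ℕ

  module IdealCompletion (_≼_ : ℕ → ℕ → Set)
    (≼-refl : ∀ {i} → i ≼ i) (≼-trans : ∀ {i j k} → i ≼ j → j ≼ k → i ≼ k)
    (≼-computable : ComputableRel (rel₂ _≼_)) where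

    record IsIdeal (J : Pred ℕ 0ℓ) : Set where
      field
        inhabited : ∃ J
        directed  : ∀ {i j} → J i → J j → ∃[ k ] J k × i ≼ k × j ≼ k
        lower     : ∀ {i j} → i ≼ j → J j → J i

    Ideal : Set (lsuc 0ℓ)
    Ideal = Σ (Pred ℕ 0ℓ) IsIdeal

    infix 4 _∋_
    _∋_ : Ideal → ℕ → Set
    (J , _) ∋ i = J i

    principal : ℕ → Ideal
    principal i = (_≼ i) , record
      { inhabited = i , ≼-refl
      ; directed  = λ j≼i k≼i → i , ≼-refl , j≼i , k≼i
      ; lower     = ≼-trans
      }

    principal-least : ∀ (J : Ideal) {i} → J ∋ i → ∀ {j} → j ≼ i → J ∋ j
    principal-least (_ , isJ) Ji j≼i = IsIdeal.lower isJ j≼i Ji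

    -- The topology is given by the base of the sets `_∋ i`; its agreement with the Scott topology
    -- is proved below.
    space : TopologicalSpace (lsuc 0ℓ) 0ℓ
    space = record
      { setoid = On.setoid {B = Ideal} (≐-setoid ℕ 0ℓ) proj₁
      ; Open   = λ U → ∀ J → U J → ∃[ i ] J ∋ i × (∀ K → K ∋ i → U K)
      ; resp-≈ = λ oU {J} {K} (J⊆K , _) UJ →
                   let (i , Ji , ↑i⊆U) = oU J UJ in ↑i⊆U K (J⊆K Ji)
      ; resp-≐ = λ (U⊆V , V⊆U) oU J VJ →
                   let (i , Ji , ↑i⊆U) = oU J (V⊆U VJ) in i , Ji , λ K Ki → U⊆V (↑i⊆U K Ki)
      ; whole  = λ (J , isJ) _ →
                   let (i , Ji) = IsIdeal.inhabited isJ in i , Ji , _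
      ; ∩-open = λ { oU oV J@(_ , isJ) (UJ , VJ) →
                   let (i , Ji , ↑i⊆U)      = oU J UJ
                       (j , Jj , ↑j⊆V)      = oV J VJ
                       (k , Jk , i≼k , j≼k) = IsIdeal.directed isJ Ji Jj
                   in k , Jk , λ K Kk →
                        ↑i⊆U K (principal-least K Kk i≼k) , ↑j⊆V K (principal-least K Kk j≼k) }
      ; ⋃-open = λ o J (x , FJ) →
                   let (i , Ji , ↑i⊆F) = o x J FJ in i , Ji , λ K Ki → x , ↑i⊆F K Ki
      }

    open TopologicalSpace space

    ∋-open : ∀ i → Open (_∋ i)
    ∋-open i J Ji = i , Ji , λ _ Ki → Ki

    ⊆⇒≤ₛ : ∀ {J K} → proj₁ J ⊆ proj₁ K → J ≤ₛ K
    ⊆⇒≤ₛ {J} {K} J⊆K oU UJ = let (i , Ji , ↑i⊆U) = oU J UJ in ↑i⊆U K (J⊆K Ji)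

    ≤ₛ⇒⊆ : ∀ {J K} → J ≤ₛ K → proj₁ J ⊆ proj₁ K
    ≤ₛ⇒⊆ J≤K {i} = J≤K (∋-open i)

    principal≤⇒∋ : ∀ {i J} → principal i ≤ₛ J → J ∋ i
    principal≤⇒∋ {i} {J} ↓i≤J = ≤ₛ⇒⊆ {principal i} {J} ↓i≤J ≼-refl

    ∋⇒principal≤ : ∀ {i J} → J ∋ i → principal i ≤ₛ J
    ∋⇒principal≤ {i} {J} Ji = ⊆⇒≤ₛ {principal i} {J} (principal-least J Ji)

    -- A neighbourhood of `J` inside the upper set of `J` contains `principal i` for some `i` in
    -- `J`, whence `J` lies below `principal i`.
    Compact⇒greatest : ∀ {J} → Compact J → ∃[ i ] J ∋ i × (∀ {j} → J ∋ j → j ≼ i)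
    Compact⇒greatest {J} (U , oU , UJ , U⊆) =
      let (i , Ji , ↑i⊆U) = oU J UJ
      in i , Ji , λ {j} → ≤ₛ⇒⊆ {J} {principal i} (U⊆ (↑i⊆U (principal i) ≼-refl)) {j}

    greatest⇒Compact : ∀ {J i} → J ∋ i → (∀ {j} → J ∋ j → j ≼ i) → Compact J
    greatest⇒Compact {J} {i} Ji max =
      (_∋ i) , ∋-open i , Ji , λ {K} Ki → ⊆⇒≤ₛ {J} {K} (λ Jj → principal-least K Ki (max Jj))

    -- The union of the ideals in `Δ`. It quantifies over ideals, so it has to be resized to level
    -- 0.
    ⋁ : {Δ : Pred Ideal (lsuc 0ℓ)} → Directed Δ → Ideal
    ⋁ {Δ} (inh , dir) = (λ i → Resize (∃[ J ] Δ J × J ∋ i)) , record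
      { inhabited = let (J , ΔJ) = inh ; (i , Ji) = IsIdeal.inhabited (proj₂ J)
                    in i , resize (J , ΔJ , Ji)
      ; directed  = λ p q →
          let (J , ΔJ , Ji) = unresize p
              (K , ΔK , Kj) = unresize q
              (L , ΔL , J≤L , K≤L)   = dir ΔJ ΔK
              (k , Lk , i≼k , j≼k) =
                IsIdeal.directed (proj₂ L) (≤ₛ⇒⊆ {J} {L} J≤L Ji) (≤ₛ⇒⊆ {K} {L} K≤L Kj)
          in k , resize (L , ΔL , Lk) , i≼k , j≼k
      ; lower     = λ i≼j p →
          let (J , ΔJ , Jj) = unresize p in resize (J , ΔJ , principal-least J Jj i≼j)
      }

    ⋁-sup : {Δ : Pred Ideal (lsuc 0ℓ)} (dir : Directed Δ) → IsSup Δ (⋁ dir)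
    ⋁-sup dir =
      (λ {J} ΔJ → ⊆⇒≤ₛ {J} {⋁ dir} (λ Ji → resize (J , ΔJ , Ji))) ,
      (λ {K} ub → ⊆⇒≤ₛ {⋁ dir} {K} (λ p →
        let (J , ΔJ , Ji) = unresize p in ≤ₛ⇒⊆ {J} {K} (ub ΔJ) Ji))

    Open⇒ScottOpen : ∀ {U} → Open U → ScottOpen U
    Open⇒ScottOpen oU =
      (λ J≤K → J≤K oU) ,
      λ {Δ} {S} dir (_ , least) US →
        let (i , Si , ↑i⊆U) = oU S US
            -- The supremum `S` lies below the union, so `i` already belongs to a member of `Δ`.
            (J , ΔJ , Ji) = unresize
              (≤ₛ⇒⊆ {S} {⋁ dir} (least {⋁ dir} (λ {J} → proj₁ (⋁-sup dir) {J})) Si)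
        in J , ΔJ , ↑i⊆U J Ji

    -- `J` is the directed supremum of the principal ideals of its elements, so a Scott open set
    -- around `J` contains one of these.
    ScottOpen⇒Open : ∀ {U} → ScottOpen U → Open U
    ScottOpen⇒Open {U} (up , inacc) J UJ =
      let (K , (i , Ji , K≤↓i) , UK) = inacc {Δ} {J} Δ-directed J-sup UJ
      in i , Ji , λ L Li → up {K} {L}
           (λ oV VK → ∋⇒principal≤ {i} {L} Li oV (K≤↓i oV VK)) UK
      where
      Δ : Pred Ideal (lsuc 0ℓ)
      -- Admitting all ideals below the principal ones preserves directedness and supremum, and `≤ₛ`
      -- has the level required of `Δ`.
      Δ K = ∃[ i ] J ∋ i × K ≤ₛ principal i
      Δ∋principal : ∀ {i} → J ∋ i → Δ (principal i)
      Δ∋principal {i} Ji = i , Ji , λ _ u → u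
      Δ-directed : Directed Δ
      Δ-directed =
        (let (i , Ji) = IsIdeal.inhabited (proj₂ J) in principal i , Δ∋principal Ji) ,
        λ { {K} {L} (i , Ji , K≤) (j , Jj , L≤) →
          let (k , Jk , i≼k , j≼k) = IsIdeal.directed (proj₂ J) Ji Jj
          in principal k , Δ∋principal Jk ,
             (λ oU u → ∋⇒principal≤ {i} {principal k} i≼k oU (K≤ oU u)) ,
             (λ oU u → ∋⇒principal≤ {j} {principal k} j≼k oU (L≤ oU u)) }
      J-sup : IsSup Δ J
      J-sup =
        (λ (i , Ji , K≤) oU u → ∋⇒principal≤ {i} {J} Ji oU (K≤ oU u)) ,
        λ {K} ub → ⊆⇒≤ₛ {J} {K} (λ {i} Ji →
          principal≤⇒∋ {i} {K} (ub {principal i} (Δ∋principal Ji)))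

    domain : ComputableAlgebraicDomain (lsuc 0ℓ) 0ℓ
    domain = record
      { space            = space
      ; isT₀             = λ {J} {K} J≤K K≤J → ≤ₛ⇒⊆ {J} {K} J≤K , ≤ₛ⇒⊆ {K} {J} K≤J
      ; directedComplete = λ dir → ⋁ dir , ⋁-sup dir
      ; scottTopology    = λ U → mk⇔ Open⇒ScottOpen ScottOpen⇒Open
      ; κ                = principal
      ; κ-compact        = λ i → greatest⇒Compact {principal i} ≼-refl (λ j≼i → j≼i)
      ; κ-surjective     = λ {J} cJ →
          let (i , Ji , max) = Compact⇒greatest {J} cJ
          in i , (λ {j} → max {j}) , principal-least J Ji
      ; isBase           =
          (λ i {J} ↓i≤J → (_∋ i) , ∋-open i , principal≤⇒∋ {i} {J} ↓i≤J ,
            λ {K} → ∋⇒principal≤ {i} {K}) ,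
          (λ oU {J} UJ →
            let (i , Ji , ↑i⊆U) = oU J UJ
            in i , ∋⇒principal≤ {i} {J} Ji ,
               λ {K} ↓i≤K → ↑i⊆U K (principal≤⇒∋ {i} {K} ↓i≤K))
      ; ≤-computable     = ComputableRel-resp
          (λ { (i ∷ j ∷ []) → mk⇔ (principal≤⇒∋ {i} {principal j}) (∋⇒principal≤ {i} {principal j}) })
          ≼-computable
      }

    -- Non-compactness in a positive form that yields witnesses: the compact ideals are those with a
    -- greatest element.
    NonPrincipal : Ideal → Set
    NonPrincipal J = ∀ i → J ∋ i → ∃[ j ] J ∋ j × ¬ (j ≼ i)

    nonCompact⇒NonPrincipal : ∀ {J} → ¬ Compact J → NonPrincipal J
    nonCompact⇒NonPrincipal {J} nc i Ji = stable λ ¬∃ →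
      nc (greatest⇒Compact {J} Ji λ {j} Jj → stable λ j⋠i → ¬∃ (j , Jj , j⋠i))

    NonPrincipal⇒nonCompact : ∀ {J} → NonPrincipal J → ¬ Compact J
    NonPrincipal⇒nonCompact {J} np cJ =
      let (i , Ji , max) = Compact⇒greatest {J} cJ
          (j , Jj , j⋠i) = np i Ji
      in j⋠i (max Jj)

    module _ (Z : NumberedSpace a ℓ r) where
      open NumberedSpace Z using () renaming (Carrier to ∣Z∣; _≈_ to _≈Z_; ξ to ζ)

      -- Replaces compactness and `principal i ≤ₛ J` by `NonPrincipal` and `J ∋ i`, so that a
      -- homeomorphism can be given in terms of sets of numbers alone.
      nonPrincipal-≅ :
        (f : ∣Z∣ → Ideal) (f-np : ∀ z → NonPrincipal (f z))
        (g : ∀ J → NonPrincipal J → ∣Z∣) →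
        (∀ {z z′} → z ≈Z z′ → proj₁ (f z) ≐ proj₁ (f z′)) →
        (∀ {J K} p q → proj₁ J ≐ proj₁ K → g J p ≈Z g K q) →
        (∀ J p → proj₁ (f (g J p)) ≐ proj₁ J) →
        (∀ z p → g (f z) p ≈Z z) →
        (A B : ℕ → Pred ℕ 0ℓ) → CE (rel₂ A) → CE (rel₂ B) →
        (∀ i z → f z ∋ i ⇔ (∃[ m ] A i m × ζ m z)) →
        (∀ m J p → ζ m (g J p) ⇔ (∃[ i ] B m i × J ∋ i)) →
        Z ≅ ComputableAlgebraicDomain.nonCompact domain
      nonPrincipal-≅ f f-np g f-cong g-cong fg gf A B ceA ceB A-spec B-spec =
        strictInverse
          {S = NumberedSpace.setoid Z}
          {T = NumberedSpace.setoid (ComputableAlgebraicDomain.nonCompact domain)}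
          (λ z → f z , NonPrincipal⇒nonCompact {f z} (f-np z))
          (λ (J , nc) → g J (nonCompact⇒NonPrincipal {J} nc))
          f-cong (λ {(J , _)} {(K , _)} → g-cong {J} {K} _ _) (λ (J , _) → fg J _) (λ z → gf z _) ,
        (A , ceA , λ i →
          (λ {z} ↓i≤ → to (A-spec i z) (principal≤⇒∋ {i} {f z} ↓i≤)) ,
          (λ {z} u → ∋⇒principal≤ {i} {f z} (from (A-spec i z) u))) ,
        (B , ceB , λ m →
          (λ {(J , _)} u → let (i , b , Ji) = to (B-spec m J _) u
                           in i , b , ∋⇒principal≤ {i} {J} Ji) ,
          (λ {(J , _)} (i , b , ↓i≤J) →
            from (B-spec m J _) (i , b , principal≤⇒∋ {i} {J} ↓i≤J)))

  -- The algebraic domain of a Π⁰₂ subset of P(ω)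

  Basic : Pred (Vec ℕ 3) 0ℓ → ℕ → Pred (Pred ℕ 0ℓ) 0ℓ
  Basic R n I = ∃[ m ] (∃[ w ] R (w ∷ n ∷ m ∷ [])) × D m ⊆ I

  -- A decidable approximation to `Basic R n`: the code `i` bounds the search for `m` and the
  -- witness `w`, and `E i` stands in for `I`.
  Stage : Pred (Vec ℕ 3) 0ℓ → ℕ → Pred ℕ 0ℓ
  Stage R i n = ∃[ m ] m < i × ∃[ w ] w < i × R (w ∷ n ∷ m ∷ []) × D m ⊆ E i

  Stage-computable : {R : Pred (Vec ℕ 3) 0ℓ} → ComputableRel R →
    ComputableRel (rel₂ (Stage R))
  Stage-computable cR = ComputableRel-resp
    {P = λ xs → ∃[ m ] m < lookup xs 0F × (∃[ w ] w < lookup xs 0F × _)}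
    (λ { (i ∷ n ∷ []) → mk⇔ (λ s → s) (λ s → s) })
    (∃<-computable 0F (∃<-computable 1F (∩-computable (rename (0F ∷ 3F ∷ 1F ∷ []) cR)
      (D⊆-computable 1F (E-computable (lookup-computable 3F) (lookup-computable 0F))))))

  module Chains (RA RB : Pred (Vec ℕ 3) 0ℓ)
    (cRA : ComputableRel RA) (cRB : ComputableRel RB) where

    Good : Pred (Pred ℕ 0ℓ) 0ℓ
    Good I = ∀ n → Basic RA n I → Basic RB n I

    infix 4 _⊑_ _≺_ _≼_

    -- The order along which `Stage` is monotone; unlike `≺` it demands no answers.
    record _⊑_ (i j : ℕ) : Set where
      constructor _,_
      field
        code≤  : i ≤ j
        subset : E i ⊆ E j

    record _≺_ (i j : ℕ) : Set where
      constructor strict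
      field
        code<    : i < j
        subset   : E i ⊆ E j
        answered : ∀ n → n < i → Stage RA i n → Stage RB j n

    open _⊑_
    open _≺_ hiding (subset)

    _≼_ : ℕ → ℕ → Set
    i ≼ j = i ≡ j ⊎ i ≺ j

    Stage-mono : ∀ R n {i j} → i ⊑ j → Stage R i n → Stage R j n
    Stage-mono R n (i≤j , i⊆j) (m , m< , w , w< , r , m⊆) =
      m , <-≤-trans m< i≤j , w , <-≤-trans w< i≤j , r , λ {k} d → i⊆j {k} (m⊆ {k} d)

    ≺⇒⊑ : ∀ {i j} → i ≺ j → i ⊑ j
    ≺⇒⊑ (strict i<j i⊆j _) = <⇒≤ i<j , λ {k} → i⊆j {k}

    -- The demands come from `i` alone, and once answered at `j` they remain answered.
    ≺-⊑-trans : ∀ {i j k} → i ≺ j → j ⊑ k → i ≺ k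
    ≺-⊑-trans (strict i<j i⊆j f) j⊑k = strict (<-≤-trans i<j (code≤ j⊑k))
      (λ {x} e → subset j⊑k {x} (i⊆j {x} e))
      (λ n n<i s → Stage-mono RB n j⊑k (f n n<i s))

    ≼⇒⊑ : ∀ {i j} → i ≼ j → i ⊑ j
    ≼⇒⊑ (inj₁ refl) = ≤-refl , λ e → e
    ≼⇒⊑ (inj₂ i≺j)  = ≺⇒⊑ i≺j

    ≺-≼-trans : ∀ {i j k} → i ≺ j → j ≼ k → i ≺ k
    ≺-≼-trans i≺j j≼k = ≺-⊑-trans i≺j (≼⇒⊑ j≼k)

    ≼-trans : ∀ {i j k} → i ≼ j → j ≼ k → i ≼ k
    ≼-trans (inj₁ refl) j≼k = j≼k
    ≼-trans (inj₂ i≺j)  j≼k = inj₂ (≺-≼-trans i≺j j≼k)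

    ≼-⋠⇒≺ : ∀ {i j k} → i ≼ k → j ≼ k → ¬ (j ≼ i) → i ≺ k
    ≼-⋠⇒≺ (inj₁ refl) j≼k j⋠i = ⊥-elim (j⋠i j≼k)
    ≼-⋠⇒≺ (inj₂ i≺k)  _   _   = i≺k

    ≼-computable : ComputableRel (rel₂ _≼_)
    ≼-computable = ComputableRel-resp
      (λ { (i ∷ j ∷ []) → mk⇔
        [ inj₁ , (λ (strict i<j i⊆j f) → inj₂ (i<j , (λ {k} → i⊆j {k}) , λ {n} → f n)) ]
        [ inj₁ , (λ (i<j , i⊆j , f) → inj₂ (strict i<j (λ {k} → i⊆j {k}) (λ _ → f))) ] })
      (∪-computable (≡-computable (lookup-computable 0F) (lookup-computable 1F))
        (∩-computable (≤-computable (suc-computable (lookup-computable 0F)) (lookup-computable 1F))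
        (∩-computable
          (D⊆E-computable)
          (∀<-computable 0F (⇒-computable
            (rename (1F ∷ 0F ∷ []) (Stage-computable cRA))
            (rename (2F ∷ 0F ∷ []) (Stage-computable cRB)))))))
      where
      D⊆E-computable : ComputableRel (λ xs → E (lookup {n = 2} xs 0F) ⊆ E (lookup xs 1F))
      D⊆E-computable = ComputableRel-resp
        (λ xs → mk⇔ (λ f {k} _ → f {k}) (λ f {k} e → f (E-bound (lookup xs 0F) {k} e) e))
        (∀<-computable 0F (⇒-computable
          (E-computable (lookup-computable 1F) (lookup-computable 0F))
          (E-computable (lookup-computable 2F) (lookup-computable 0F))))

    open IdealCompletion _≼_ (inj₁ refl) ≼-trans ≼-computable public

    -- What the codes of all finite subsets of `I` share with a non-principal ideal of union `I`:
    -- they exhaust `I` by finite sets at arbitrarily late stages.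
    record Cofinal (K I : Pred ℕ 0ℓ) : Set where
      field
        sound : ∀ {i} → K i → E i ⊆ I
        cover : ∀ m s → D m ⊆ I → ∃[ l ] K l × s ≤ l × D m ⊆ E l
        join  : ∀ {i j} → K i → K j → ∃[ l ] K l × i ⊑ l × j ⊑ l

    module _ {K I : Pred ℕ 0ℓ} (cof : Cofinal K I) where
      open Cofinal cof

      Basic⇒Stage : ∀ R n → Basic R n I → ∃[ l ] K l × Stage R l n
      Basic⇒Stage R n (m , (w , r) , m⊆I) =
        -- A code from `m + w + 1` on exceeds both the index and the witness.
        let (l , Kl , s≤l , m⊆l) = cover m (suc (m + w)) (λ {k} → m⊆I {k})
        in l , Kl , m , ≤-trans (s≤s (m≤m+n m w)) s≤l ,
           w , ≤-trans (s≤s (m≤n+m w m)) s≤l , r , λ {k} → m⊆l {k}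

      Stage⇒Basic : ∀ R n {l} → K l → Stage R l n → Basic R n I
      Stage⇒Basic R n Kl (m , _ , w , _ , r , m⊆l) =
        m , (w , r) , λ {k} d → sound Kl {k} (m⊆l {k} d)

      -- Finitely many n < i have to be answered, so the directed set K
      -- contains a code answering all of them at once.
      dense : Good I → ∀ {i} → E i ⊆ I → ∃[ l ] K l × i ≺ l
      dense good {i} i⊆I =
        let (a , a⊆ , a⊇)          = E-finite i
            (l , Kl , i<l , a⊆l)   = cover a (suc i) (λ {k} d → i⊆I {k} (a⊆ {k} d))
            (l′ , Kl′ , met)       = collect _⊑_ K (l , Kl) join {Stage RA i} (λ _ → em)
                                       (λ n l → Stage RB l n) (Stage-mono RB) i answer
            (l″ , Kl″ , l⊑l″ , l′⊑l″) = join Kl Kl′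
        in l″ , Kl″ , strict (<-≤-trans i<l (code≤ l⊑l″))
             (λ {k} e → subset l⊑l″ {k} (a⊆l {k} (a⊇ {k} e)))
             (λ n n<i s → Stage-mono RB n l′⊑l″ (met n n<i s))
        where
        answer : ∀ n → Stage RA i n → ∃[ l ] K l × Stage RB l n
        answer n (m , _ , w , _ , r , m⊆i) =
          Basic⇒Stage RB n (good n (m , (w , r) , λ {k} d → i⊆I {k} (m⊆i {k} d)))

    record Below (I : Pred ℕ 0ℓ) (i : ℕ) : Set where
      constructor below
      field
        E⊆ : E i ⊆ I

    open Below

    Below-cofinal : ∀ I → Cofinal (Below I) I
    Below-cofinal I = record
      { sound = λ i∈ {k} → E⊆ i∈ {k}
      ; cover = λ m s m⊆I →
          let (l , s≤l , l⊆m , m⊆l) = E-surjective m s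
          in l , below (λ {k} e → m⊆I {k} (l⊆m {k} e)) , s≤l , λ {k} → m⊆l {k}
      ; join  = λ {i} {j} i∈ j∈ →
          let (a , a⊆i , i⊆a)         = E-finite i
              (b , b⊆j , j⊆b)         = E-finite j
              (c , c⊆ , ⊆c)           = D-∪ a b
              (l , i+j≤l , l⊆c , c⊆l) = E-surjective c (i + j)
          in l ,
             below (λ {k} e → [ (λ d → E⊆ i∈ {k} (a⊆i {k} d)) , (λ d → E⊆ j∈ {k} (b⊆j {k} d)) ]
               (c⊆ {k} (l⊆c {k} e))) ,
             (≤-trans (m≤m+n i j) i+j≤l , λ {k} e → c⊆l {k} (⊆c {k} (inj₁ (i⊆a {k} e)))) ,
             (≤-trans (m≤n+m j i) i+j≤l , λ {k} e → c⊆l {k} (⊆c {k} (inj₂ (j⊆b {k} e))))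
      }

    Below-dense : ∀ {I} → Good I → ∀ {i} → Below I i → ∃[ l ] Below I l × i ≺ l
    Below-dense {I} good {i} i∈ = dense (Below-cofinal I) good {i} (λ {k} → E⊆ i∈ {k})

    belowIdeal : ∀ {I} → Good I → Ideal
    belowIdeal {I} good = Below I , record
      { inhabited = map₂ proj₁ (cover 0 0 (λ {k} d → ⊥-elim (D-zero k d)))
      -- `join` only bounds in the sense of `⊑`; raising both codes by density first makes the bound
      -- one for `≺`.
      ; directed  = λ i∈ j∈ →
          let (k , k∈ , i≺k)       = Below-dense good i∈
              (l , l∈ , j≺l)       = Below-dense good j∈
              (x , x∈ , k⊑x , l⊑x) = join k∈ l∈
          in x , x∈ , inj₂ (≺-⊑-trans i≺k k⊑x) , inj₂ (≺-⊑-trans j≺l l⊑x)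
      ; lower     = λ i≼j j∈ → below (λ {k} e → E⊆ j∈ {k} (subset (≼⇒⊑ i≼j) {k} e))
      }
      where open Cofinal (Below-cofinal I)

    belowIdeal-NonPrincipal : ∀ {I} (good : Good I) → NonPrincipal (belowIdeal good)
    belowIdeal-NonPrincipal good i i∈ =
      let (l , l∈ , i≺l) = Below-dense good i∈
      in l , l∈ , λ l≼i → n≮n i (code< (≺-≼-trans i≺l l≼i))

    ⋃E : Pred ℕ 0ℓ → Pred ℕ 0ℓ
    ⋃E J k = ∃[ i ] J i × E i k

    module _ (J : Ideal) (nonPrincipal : NonPrincipal J) where
      open IsIdeal (proj₂ J)

      ascend : ∀ {i} → J ∋ i → ∃[ j ] J ∋ j × i ≺ j
      ascend Ji =
        let (j , Jj , j⋠i)       = nonPrincipal _ Ji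
            (k , Jk , i≼k , j≼k) = directed Ji Jj
        in k , Jk , ≼-⋠⇒≺ i≼k j≼k j⋠i

      -- Each step of `ascend` increases the code.
      unbounded : ∀ s → ∃[ i ] J ∋ i × s ≤ i
      unbounded zero    = map₂ (_, z≤n) inhabited
      unbounded (suc s) =
        let (i , Ji , s≤i)   = unbounded s
            (j , Jj , i≺j) = ascend Ji
        in j , Jj , ≤-<-trans s≤i (code< i≺j)

      ideal-join : ∀ {i j} → J ∋ i → J ∋ j → ∃[ l ] J ∋ l × i ⊑ l × j ⊑ l
      ideal-join Ji Jj =
        let (l , Jl , i≼l , j≼l) = directed Ji Jj in l , Jl , ≼⇒⊑ i≼l , ≼⇒⊑ j≼l

      ideal-cofinal : Cofinal (J ∋_) (⋃E (J ∋_))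
      ideal-cofinal = record
        { sound = λ {i} Ji {k} e → i , Ji , e
        ; cover = λ m s m⊆ →
            let (l , Jl , m⊆l)    = collect _⊑_ (J ∋_) inhabited ideal-join {D m} (D? m)
                                      (λ k l → E l k) (λ k x⊑y → subset x⊑y {k}) m
                                      (λ k d → m⊆ {k} d)
                (l′ , Jl′ , s≤l′) = unbounded s
                (l″ , Jl″ , l⊑l″ , l′⊑l″) = ideal-join Jl Jl′
            in l″ , Jl″ , ≤-trans s≤l′ (code≤ l′⊑l″) ,
               λ {k} d → subset l⊑l″ {k} (m⊆l k (D-bound m {k} d) d)
        ; join  = ideal-join
        }

      -- Some code in `J` sees `Basic RA n`. Once it is also raised beyond `n`, the demand `n` binds
      -- it, and the next strict step in `J` answers.
      ⋃E-good : Good (⋃E (J ∋_))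
      ⋃E-good n basic =
        let (l , Jl , s)             = Basic⇒Stage ideal-cofinal RA n basic
            (l₁ , Jl₁ , n<l₁)        = unbounded (suc n)
            (l₂ , Jl₂ , l⊑l₂ , l₁⊑l₂) = ideal-join Jl Jl₁
            (l₃ , Jl₃ , l₂≺l₃)       = ascend Jl₂
        in Stage⇒Basic ideal-cofinal RB n Jl₃
             (answered l₂≺l₃ n (<-≤-trans n<l₁ (code≤ l₁⊑l₂)) (Stage-mono RA n l⊑l₂ s))

      -- A non-principal ideal is recovered from its union: by density every code of a finite subset
      -- of the union lies below a member of `J`.
      below-⋃E : Below (⋃E (J ∋_)) ⊆ (J ∋_)
      below-⋃E {i} i∈ =
        let (l , Jl , i≺l) = dense ideal-cofinal ⋃E-good {i} (λ {k} → E⊆ i∈ {k})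
        in lower (inj₂ i≺l) Jl

    homeomorphism : ∀ {S : Pred (Pred ℕ 0ℓ) 0ℓ} → S ≐ Good →
      numberedSubspace Pω S ≅ ComputableAlgebraicDomain.nonCompact domain
    homeomorphism {S} (S⊆ , S⊇) = nonPrincipal-≅ (numberedSubspace Pω S)
      (λ (_ , s) → belowIdeal (S⊆ s))
      (λ (_ , s) → belowIdeal-NonPrincipal (S⊆ s))
      (λ J p → ⋃E (J ∋_) , S⊇ (⋃E-good J p))
      (λ (I⊆I′ , I′⊆I) → (λ i∈ → below (λ {k} e → I⊆I′ (E⊆ i∈ {k} e))) ,
                         (λ i∈ → below (λ {k} e → I′⊆I (E⊆ i∈ {k} e))))
      (λ _ _ (J⊆K , K⊆J) → (λ (i , Ji , e) → i , J⊆K Ji , e) , (λ (i , Ki , e) → i , K⊆J Ki , e))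
      (λ J p → below-⋃E J p , λ {i} Ji → below (λ {k} e → i , Ji , e))
      (λ (I , s) _ →
        (λ {k} (i , i∈ , e) → E⊆ i∈ {k} e) ,
        λ {k} Ik →
          let (m , m⊆ , m⊇)      = singleton k
              (l , l∈ , _ , m⊆l) = Cofinal.cover (Below-cofinal I) m 0
                                     (λ {x} d → subst I (sym (m⊆ {x} d)) Ik)
          in l , l∈ , m⊆l {k} (m⊇ refl))
      -- The upper set of `i` pulls back to the sets containing `E i`, and the basic open set of `m`
      -- to the ideals with a member `i` such that `D m ⊆ E i`.
      (λ i m → E i ⊆ D m)
      (λ m i → D m ⊆ E i)
      (Computable⇒CE (ComputableRel-resp
        (λ { (i ∷ m ∷ []) → mk⇔ (λ f {k} _ → f {k}) (λ f {k} e → f (E-bound i {k} e) e) })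
        (∀<-computable 0F (⇒-computable
          (E-computable (lookup-computable 1F) (lookup-computable 0F))
          (D-computable (lookup-computable 2F) (lookup-computable 0F))))))
      (Computable⇒CE (ComputableRel-resp
        (λ { (m ∷ i ∷ []) → mk⇔ (λ f {k} → f {k}) (λ f {k} → f {k}) })
        (D⊆-computable 0F (E-computable (lookup-computable 2F) (lookup-computable 0F)))))
      (λ i z → mk⇔
        (λ i∈ → let (a , a⊆i , i⊆a) = E-finite i
                in a , (λ {k} → i⊆a {k}) , λ {k} d → E⊆ i∈ {k} (a⊆i {k} d))
        (λ (m , i⊆m , m⊆I) → below (λ {k} e → m⊆I {k} (i⊆m {k} e))))
      (λ m J p → mk⇔
        (λ m⊆ → let (l , Jl , _ , m⊆l) = Cofinal.cover (ideal-cofinal J p) m 0 (λ {k} → m⊆ {k})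
                in l , (λ {k} → m⊆l {k}) , Jl)
        (λ (l , m⊆l , Jl) {k} d → l , Jl , m⊆l {k} d))

  Π⁰₂⇒algebraic : ∀ {S : Pred (Pred ℕ 0ℓ) 0ℓ} → Π⁰₂ Pω S →
    Σ[ Y ∈ ComputableAlgebraicDomain (lsuc 0ℓ) 0ℓ ]
      numberedSubspace Pω S ≅ ComputableAlgebraicDomain.nonCompact Y
  Π⁰₂⇒algebraic {S} (A , B , (RA , cRA , specA) , (RB , cRB , specB) , S∁⊆ , S∁⊇) =
    domain , homeomorphism (S⇒Good , Good⇒S)
    where
    open Chains RA RB cRA cRB
    S⇒Good : S ⊆ Good
    S⇒Good s n (m , w , m⊆I) = stable λ ¬v → S∁⊇
      (n , (m , from (specA (n ∷ m ∷ [])) w , λ {k} → m⊆I {k}) ,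
       λ (m′ , b , m′⊆I) → ¬v (m′ , to (specB (n ∷ m′ ∷ [])) b , λ {k} → m′⊆I {k})) s
    Good⇒S : Good ⊆ S
    Good⇒S good = stable λ ¬s →
      let (n , (m , a , m⊆I) , ¬v) = S∁⊆ ¬s
          (m′ , w , m′⊆I) = good n (m , to (specA (n ∷ m ∷ [])) a , λ {k} → m⊆I {k})
      in ¬v (m′ , from (specB (n ∷ m′ ∷ [])) w , λ {k} → m′⊆I {k})

-- The specialization order and the relation `≪`

module _ (T : TopologicalSpace c ℓ) where
  open TopologicalSpace T

  ≪⇒≤ₛ : ∀ {x y} → x ≪ y → x ≤ₛ y
  ≪⇒≤ₛ (_ , _ , y∈U , U⊆) = U⊆ y∈U

  ≪-≤ₛ-trans : ∀ {x y z} → x ≪ y → y ≤ₛ z → x ≪ z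
  ≪-≤ₛ-trans (U , oU , y∈U , U⊆) y≤z = U , oU , y≤z oU y∈U , λ {w} → U⊆ {w}

  ≤ₛ-≪-trans : ∀ {x y z} → x ≤ₛ y → y ≪ z → x ≪ z
  ≤ₛ-≪-trans x≤y (U , oU , z∈U , U⊆) = U , oU , z∈U , λ w∈U oV x∈V → U⊆ w∈U oV (x≤y oV x∈V)

  ≈⇒≤ₛ : ∀ {x y} → x ≈ y → x ≤ₛ y
  ≈⇒≤ₛ x≈y oU = resp-≈ oU x≈y

-- Algebraic domains as continuous domains

module AlgebraicIsContinuous (Y : ComputableAlgebraicDomain c ℓ) where
  open ComputableAlgebraicDomain Y renaming (≤-computable to κ≤-computable)

  κ≤⇒κ≪ : ∀ {i y} → κ i ≤ₛ y → κ i ≪ y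
  κ≤⇒κ≪ {i} {y} = ≪-≤ₛ-trans space {κ i} {κ i} {y} (κ-compact i)

  κ≪⇒κ≤ : ∀ {i y} → κ i ≪ y → κ i ≤ₛ y
  κ≪⇒κ≤ {i} {y} = ≪⇒≤ₛ space {κ i} {y}

  continuousDomain : ComputableDomain c ℓ
  continuousDomain = record
    { space            = space
    ; isT₀             = isT₀
    ; directedComplete = directedComplete
    ; scottTopology    = scottTopology
    ; b                = κ
    ; isBase           =
        (λ i {y} (U , oU , y∈U , U⊆) → U , oU , y∈U , λ {z} z∈U → U , oU , z∈U , λ {w} → U⊆ {w}) ,
        (λ oU {y} y∈U →
          let (i , κ≤y , ↑κ⊆U) = proj₂ isBase oU y∈U
          in i , κ≤⇒κ≪ {i} {y} κ≤y , λ {z} κ≪z → ↑κ⊆U (κ≪⇒κ≤ {i} {z} κ≪z))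
    ; approx-directed  = λ y →
        (let (i , κ≤y , _) = proj₂ isBase whole {y} _
         in κ i , i , Setoid.refl setoid , κ≤⇒κ≪ {i} {y} κ≤y) ,
        λ { {x} {x′} (i , x≈κ , κ≪y) (j , x′≈κ , κ≪′y) →
          let (U , oU , y∈U , U⊆) = κ≪y
              (V , oV , y∈V , V⊆) = κ≪′y
              -- A compact element in both neighbourhoods lies above both approximants.
              (k , κ≤y , ↑κ⊆U∩V) = proj₂ isBase (∩-open oU oV) (y∈U , y∈V)
              (κk∈U , κk∈V) = ↑κ⊆U∩V {κ k} (λ _ u → u)
          in κ k , (k , Setoid.refl setoid , κ≤⇒κ≪ {k} {y} κ≤y) ,
             (λ oW x∈W → U⊆ κk∈U oW (resp-≈ oW x≈κ x∈W)) ,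
             (λ oW x∈W → V⊆ κk∈V oW (resp-≈ oW x′≈κ x∈W)) }
    ; approx-sup       = λ y →
        (λ (i , x≈κ , κ≪y) oU x∈U → κ≪⇒κ≤ {i} {y} κ≪y oU (resp-≈ oU x≈κ x∈U)) ,
        λ {z} ub oU y∈U →
          let (i , κ≤y , ↑κ⊆U) = proj₂ isBase oU y∈U
          in ↑κ⊆U (ub {κ i} (i , Setoid.refl setoid , κ≤⇒κ≪ {i} {y} κ≤y))
    ; ≪-computable     = ComputableRel-resp
        (λ { (i ∷ j ∷ []) → mk⇔ (κ≪⇒κ≤ {i} {κ j}) (κ≤⇒κ≪ {i} {κ j}) }) κ≤-computable
    }

  nonCompact-≅ : {X : NumberedSpace a ℓ′ r} →
    X ≅ nonCompact → X ≅ ComputableDomain.nonCompact continuousDomain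
  nonCompact-≅ {X = X} (h , (A , ceA , A-spec) , (B , ceB , B-spec)) = h ,
    (A , ceA , λ i →
      (λ {x} κ≪ → proj₁ (A-spec i) {x} (κ≪⇒κ≤ {i} {proj₁ (Inverse.to h x)} κ≪)) ,
      (λ {x} u → κ≤⇒κ≪ {i} {proj₁ (Inverse.to h x)} (proj₂ (A-spec i) {x} u))) ,
    (B , ceB , λ i →
      (λ {(y , _)} u → let (k , b , κ≤) = proj₁ (B-spec i) u in k , b , κ≤⇒κ≪ {k} {y} κ≤) ,
      (λ {(y , _)} (k , b , κ≪) → proj₂ (B-spec i) (k , b , κ≪⇒κ≤ {k} {y} κ≪)))

-- Non-compact elements of a continuous domain as a Π⁰₂ subset of P(ω)

module NonCompactIsQuasiPolish (em : ∀ {a} → ExcludedMiddle a)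
  (Y : ComputableDomain (lsuc 0ℓ) 0ℓ) where
  open ComputableDomain Y

  private
    χ : Vec ℕ 2 → ℕ
    χ = proj₁ ≪-computable

  -- The relation `b i ≪ b j`, brought down to level 0 through its characteristic function.
  record _◁_ (i j : ℕ) : Set where
    constructor approximates
    field χ≡0 : χ (i ∷ j ∷ []) ≡ 0

  ◁⇒≪ : ∀ {i j} → i ◁ j → b i ≪ b j
  ◁⇒≪ {i} {j} (approximates eq) = from (proj₂ (proj₂ ≪-computable) (i ∷ j ∷ [])) eq

  ≪⇒◁ : ∀ {i j} → b i ≪ b j → i ◁ j
  ≪⇒◁ {i} {j} p = approximates (to (proj₂ (proj₂ ≪-computable) (i ∷ j ∷ [])) p)

  ◁-computable : ComputableRel (rel₂ _◁_)
  ◁-computable = ComputableRel-resp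
    (λ { (i ∷ j ∷ []) → mk⇔ (◁⇒≪ {i} {j}) (≪⇒◁ {i} {j}) }) ≪-computable

  -- The disjunct D m i lets n itself witness the premise when D n ⊆ I, the
  -- other one forces I to be closed downwards under ◁.
  Premise : ℕ → Pred ℕ 0ℓ
  Premise n m = D n ⊆ (λ i → D m i ⊎ ∃[ j ] D m j × i ◁ j)

  -- `D m` holds an upper bound `k` of `D n`, a `j` showing that `k` is not greatest, and `D n`
  -- itself, which yields closure downwards.
  Conclusion : ℕ → Pred ℕ 0ℓ
  Conclusion n m = ∃[ k ] D m k × ∃[ j ] D m j × ¬ (j ◁ k) × D n ⊆ (λ i → D m i × i ◁ k)

  Premise-computable : ComputableRel (rel₂ Premise)
  Premise-computable = ComputableRel-resp
    (λ { (n ∷ m ∷ []) → mk⇔ (λ f {k} → f {k}) (λ f {k} → f {k}) })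
    (D⊆-computable 0F (∪-computable
      (D-computable (lookup-computable 2F) (lookup-computable 0F))
      (∃∈D-computable 2F (rename (1F ∷ 0F ∷ []) ◁-computable))))

  Conclusion-computable : ComputableRel (rel₂ Conclusion)
  Conclusion-computable = ComputableRel-resp
    (λ { (n ∷ m ∷ []) → mk⇔ (λ p → p) (λ p → p) })
    (∃∈D-computable 1F (∃∈D-computable 2F (∩-computable
      (∁-computable (rename (0F ∷ 1F ∷ []) ◁-computable))
      (D⊆-computable 2F (∩-computable
        (D-computable (lookup-computable 4F) (lookup-computable 0F))
        (rename (0F ∷ 2F ∷ []) ◁-computable))))))

  Meets : (ℕ → Pred ℕ 0ℓ) → ℕ → Pred (Pred ℕ 0ℓ) 0ℓ
  Meets A n I = ∃[ m ] A n m × D m ⊆ I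

  S : Pred (Pred ℕ 0ℓ) 0ℓ
  S I = ∀ n → Meets Premise n I → Meets Conclusion n I

  S-Π⁰₂ : Π⁰₂ Pω S
  S-Π⁰₂ = Premise , Conclusion ,
    Computable⇒CE Premise-computable , Computable⇒CE Conclusion-computable ,
    (λ ¬s → stable em λ ¬∃ → ¬s λ n p → stable em λ ¬c → ¬∃ (n , p , ¬c)) ,
    (λ (n , p , ¬c) s → ¬c (s n p))

  module _ {I : Pred ℕ 0ℓ} (s : S I) where

    bound : ∀ n → D n ⊆ I → ∃[ k ] I k × ∃[ j ] I j × ¬ (j ◁ k) × D n ⊆ (_◁ k)
    bound n n⊆I =
      let (m , (k , mk , j , mj , ¬◁ , f) , m⊆I) =
            s n (n , (λ {i} d → inj₁ d) , λ {i} → n⊆I {i})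
      in k , m⊆I {k} mk , j , m⊆I {j} mj , ¬◁ , λ {i} d → proj₂ (f {i} d)

    bound₁ : ∀ i → I i → ∃[ k ] I k × ∃[ j ] I j × ¬ (j ◁ k) × i ◁ k
    bound₁ i Ii =
      let (n , n⊆ , n⊇) = singleton i
          (k , Ik , j , Ij , ¬◁ , f) = bound n (λ {x} d → subst I (sym (n⊆ {x} d)) Ii)
      in k , Ik , j , Ij , ¬◁ , f {i} (n⊇ refl)

    -- The second disjunct of `Premise` applies to the singletons of `i` and `j`, and `Conclusion`
    -- puts `i` into a finite subset of `I`.
    ◁-lower : ∀ {i j} → i ◁ j → I j → I i
    ◁-lower {i} {j} i◁j Ij =
      let (n , n⊆ , n⊇) = singleton i
          (m , m⊆ , m⊇) = singleton j
          (m′ , (_ , _ , _ , _ , _ , f) , m′⊆I) = s n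
            (m , (λ {x} d → inj₂ (j , m⊇ refl , subst (_◁ j) (sym (n⊆ {x} d)) i◁j)) ,
             λ {x} d → subst I (sym (m⊆ {x} d)) Ij)
      in m′⊆I {i} (proj₁ (f {i} (n⊇ refl)))

    Down : Pred Carrier (lsuc 0ℓ)
    Down x = ∃[ i ] I i × x ≤ₛ b i

    b∈Down : ∀ {i} → I i → Down (b i)
    b∈Down {i} Ii = i , Ii , λ _ u → u

    Down-directed : Directed Down
    Down-directed =
      -- The upper bound of the empty set provides an element.
      (let (k , Ik , _) = bound 0 (λ {x} d → ⊥-elim (D-zero x d)) in b k , b∈Down Ik) ,
      λ { (i , Ii , x≤) (j , Ij , y≤) →
        let (n , n⊆ , n⊇) = singleton i
            (l , l⊆ , l⊇) = adjoin n j
            (k , Ik , _ , _ , _ , f) = bound l (λ {x} d →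
              [ (λ d → subst I (sym (n⊆ {x} d)) Ii) , (λ eq → subst I (sym eq) Ij) ] (l⊆ {x} d))
            i≤k = ≪⇒≤ₛ space {b i} {b k} (◁⇒≪ (f {i} (l⊇ {i} (inj₁ (n⊇ {i} refl)))))
            j≤k = ≪⇒≤ₛ space {b j} {b k} (◁⇒≪ (f {j} (l⊇ {j} (inj₂ refl))))
        in b k , b∈Down Ik , (λ oU u → i≤k oU (x≤ oU u)) , (λ oU u → j≤k oU (y≤ oU u)) }

    sup : Carrier
    sup = proj₁ (directedComplete Down-directed)

    sup-isSup : IsSup Down sup
    sup-isSup = proj₂ (directedComplete Down-directed)

    b≤sup : ∀ {i} → I i → b i ≤ₛ sup
    b≤sup {i} Ii = proj₁ sup-isSup {b i} (b∈Down Ii)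

    ∈⇒≪sup : ∀ {i} → I i → b i ≪ sup
    ∈⇒≪sup {i} Ii =
      let (k , Ik , _ , _ , _ , i◁k) = bound₁ i Ii
      in ≪-≤ₛ-trans space {b i} {b k} {sup} (◁⇒≪ i◁k) (b≤sup Ik)

    open-meets : ∀ {U} → Open U → U sup → ∃[ k ] I k × U (b k)
    open-meets {U} oU u =
      let (x , (k , Ik , x≤b) , x∈U) =
            proj₂ (to (scottTopology U) oU) Down-directed sup-isSup u
      in k , Ik , x≤b oU x∈U

    -- The open set witnessing `b i ≪ sup` contains `b k` for some `k` in `I`, so `i ◁ k`.
    ≪sup⇒∈ : ∀ {i} → b i ≪ sup → I i
    ≪sup⇒∈ {i} (U , oU , u , U⊆) =
      let (k , Ik , bk∈U) = open-meets oU u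
      in ◁-lower (≪⇒◁ (U , oU , bk∈U , λ {w} → U⊆ {w})) Ik

    -- A compact `sup` would lie below `b i` for some `i` in `I`. With `k` and `j` from `bound₁ i`,
    -- this makes `b j ≪ sup ≤ b i ≤ b k`, against `¬ (j ◁ k)`.
    sup-nonCompact : ¬ Compact sup
    sup-nonCompact (U , oU , u , U⊆) =
      let (i , Ii , bi∈U)              = open-meets oU u
          (k , Ik , j , Ij , ¬j◁k , i◁k) = bound₁ i Ii
          sup≤bi : sup ≤ₛ b i
          sup≤bi = U⊆ bi∈U
          bj≪bi : b j ≪ b i
          bj≪bi = ≪-≤ₛ-trans space {b j} {sup} {b i} (∈⇒≪sup Ij) sup≤bi
      in ¬j◁k (≪⇒◁ (≪-≤ₛ-trans space {b j} {b i} {b k} bj≪bi (≪⇒≤ₛ space {b i} {b k} (◁⇒≪ i◁k))))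

  Approx : Carrier → Pred ℕ 0ℓ
  Approx y i = Resize em (b i ≪ y)

  approx : ∀ {y i} → b i ≪ y → Approx y i
  approx = resize em

  unapprox : ∀ {y i} → Approx y i → b i ≪ y
  unapprox = unresize em

  Approx-mono : ∀ {y z} → y ≤ₛ z → Approx y ⊆ Approx z
  Approx-mono {y} {z} y≤z {i} p =
    approx {z} {i} (≪-≤ₛ-trans space {b i} {y} {z} (unapprox {y} {i} p) y≤z)

  Approx-reflects : ∀ {y z} → Approx y ⊆ Approx z → y ≤ₛ z
  Approx-reflects {y} {z} y⊆z = proj₂ (approx-sup y) {z}
    λ {x} (i , x≈b , b≪y) oU x∈U →
      ≪⇒≤ₛ space {b i} {z} (unapprox {z} {i} (y⊆z {i} (approx {y} {i} b≪y))) oU (resp-≈ oU x≈b x∈U)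

  -- The interpolation property: the witnessing open set is Scott open, so it contains an
  -- approximant of `y`.
  interpolate : ∀ {i y} → b i ≪ y → ∃[ k ] b k ≪ y × i ◁ k
  interpolate {i} {y} (U , oU , y∈U , U⊆) =
    let (x , (k , x≈b , b≪y) , x∈U) =
          proj₂ (to (scottTopology U) oU) (approx-directed y) (approx-sup y) y∈U
    in k , b≪y , ≪⇒◁ (U , oU , resp-≈ oU x≈b x∈U , λ {w} → U⊆ {w})

  interpolate-finite : ∀ n {y} → D n ⊆ Approx y → ∃[ k ] b k ≪ y × D n ⊆ (_◁ k)
  interpolate-finite n {y} n⊆ =
    let (k , b≪y , f) = collect (λ i j → b i ≤ₛ b j) (λ k → b k ≪ y) inh join {D n} (D? n)
                          _◁_ (λ i {x} {z} x≤z i◁x →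
                            ≪⇒◁ (≪-≤ₛ-trans space {b i} {b x} {b z} (◁⇒≪ i◁x) x≤z)) n
                          (λ i d → interpolate {i} {y} (unapprox {y} {i} (n⊆ {i} d)))
    in k , b≪y , λ {i} d → f i (D-bound n {i} d) d
    where
    inh : ∃[ k ] b k ≪ y
    inh = let (_ , (k , _ , b≪y)) = proj₁ (approx-directed y) in k , b≪y
    join : ∀ {i j} → b i ≪ y → b j ≪ y → ∃[ k ] b k ≪ y × b i ≤ₛ b k × b j ≤ₛ b k
    join {i} {j} i≪y j≪y =
      let (z , (k , z≈b , b≪y) , i≤z , j≤z) = proj₂ (approx-directed y) {b i} {b j}
            (i , Setoid.refl setoid , i≪y) (j , Setoid.refl setoid , j≪y)
      in k , b≪y , (λ oU u → resp-≈ oU z≈b (i≤z oU u)) , (λ oU u → resp-≈ oU z≈b (j≤z oU u))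

  -- Otherwise `b k` bounds all approximants of `y`, so `y ≤ b k ≪ y` and `y` is compact.
  nonCompact⇒unbounded : ∀ {y} → ¬ Compact y → ∀ {k} → b k ≪ y → ∃[ j ] b j ≪ y × ¬ (j ◁ k)
  nonCompact⇒unbounded {y} nc {k} b≪y = stable em λ ¬∃ →
    nc (≤ₛ-≪-trans space {y} {b k} {y}
      (proj₂ (approx-sup y) {b k} λ {x} (j , x≈b , bj≪y) oU x∈U →
        ≪⇒≤ₛ space {b j} {b k} (◁⇒≪ (stable em λ ¬◁ → ¬∃ (j , bj≪y , ¬◁))) oU (resp-≈ oU x≈b x∈U))
      b≪y)

  -- Comparing elements of S would otherwise unfold this proof.
  abstract
    Approx-S : ∀ {y} → ¬ Compact y → S (Approx y)
    Approx-S {y} nc n (m , pre , m⊆) =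
      let (k , bk≪y , n◁k)  = interpolate-finite n {y} (λ {i} → n⊆ {i})
          (j , bj≪y , ¬j◁k) = nonCompact⇒unbounded {y} nc {k} bk≪y
          (e , e⊆ , e⊇)     = adjoin n k
          (l , l⊆ , l⊇)     = adjoin e j
          e⊆I : D e ⊆ Approx y
          e⊆I = λ {i} d →
            [ n⊆ {i} , (λ eq → subst (Approx y) (sym eq) (approx {y} {k} bk≪y)) ] (e⊆ {i} d)
      in l ,
         (k , l⊇ {k} (inj₁ (e⊇ {k} (inj₂ refl))) , j , l⊇ {j} (inj₂ refl) , ¬j◁k ,
          λ {i} d → l⊇ {i} (inj₁ (e⊇ {i} (inj₁ d))) , n◁k {i} d) ,
         λ {i} d → [ e⊆I {i} , (λ eq → subst (Approx y) (sym eq) (approx {y} {j} bj≪y)) ] (l⊆ {i} d)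
      where
      below : ∀ i → (∃[ j ] D m j × i ◁ j) → Approx y i
      below i (j , d , i◁j) = approx {y} {i} (≪-≤ₛ-trans space {b i} {b j} {y} (◁⇒≪ i◁j)
        (≪⇒≤ₛ space {b j} {y} (unapprox {y} {j} (m⊆ {j} d))))
      n⊆ : D n ⊆ Approx y
      n⊆ {i} d = [ m⊆ {i} , below i ] (pre {i} d)

  Approx-sup : ∀ {I} (s : S I) → Approx (sup s) ≐ I
  Approx-sup s =
    (λ {i} p → ≪sup⇒∈ s (unapprox {sup s} {i} p)) , (λ {i} Ii → approx {sup s} {i} (∈⇒≪sup s Ii))

  Approx-cong : ∀ {y z} → y ≈ z → Approx y ≐ Approx z
  Approx-cong {y} {z} y≈z =
    (λ {i} → Approx-mono {y} {z} (≈⇒≤ₛ space y≈z) {i}) ,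
    (λ {i} → Approx-mono {z} {y} (≈⇒≤ₛ space (Setoid.sym setoid y≈z)) {i})

  Approx-injective : ∀ {y z} → Approx y ≐ Approx z → y ≈ z
  Approx-injective {y} {z} (y⊆z , z⊆y) =
    isT₀ (Approx-reflects {y} {z} (λ {i} → y⊆z {i})) (Approx-reflects {z} {y} (λ {i} → z⊆y {i}))

  sup-Approx : ∀ y (s : S (Approx y)) → sup {Approx y} s ≈ y
  sup-Approx y s = Approx-injective {sup {Approx y} s} {y} (Approx-sup {Approx y} s)

  sup-cong : ∀ {I I′} (s : S I) (s′ : S I′) → I ≐ I′ → sup {I} s ≈ sup {I′} s′
  sup-cong {I} {I′} s s′ (I⊆I′ , I′⊆I) = Approx-injective {sup {I} s} {sup {I′} s′}
    ((λ {i} p → proj₂ (Approx-sup {I′} s′) {i} (I⊆I′ {i} (proj₁ (Approx-sup {I} s) {i} p))) ,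
     (λ {i} p → proj₂ (Approx-sup {I} s) {i} (I′⊆I {i} (proj₁ (Approx-sup {I′} s′) {i} p))))

  nonCompact↔S :
    Inverse (NumberedSpace.setoid nonCompact) (NumberedSpace.setoid (numberedSubspace Pω S))
  nonCompact↔S = strictInverse
    {S = NumberedSpace.setoid nonCompact} {T = NumberedSpace.setoid (numberedSubspace Pω S)}
    to-S from-S
    (λ {(y , _)} {(z , _)} → Approx-cong {y} {z})
    (λ {(I , s)} {(I′ , s′)} → sup-cong {I} {I′} s s′)
    (λ (I , s) → Approx-sup {I} s)
    (λ (y , nc) → sup-Approx y (Approx-S {y} nc))
    where
    to-S : Σ Carrier (∁ Compact) → Σ (Pred ℕ 0ℓ) S
    to-S (y , nc) = Approx y , Approx-S {y} nc
    from-S : Σ (Pred ℕ 0ℓ) S → Σ Carrier (∁ Compact)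
    from-S (I , s) = sup {I} s , sup-nonCompact {I} s

  nonCompact-≅ : nonCompact ≅ numberedSubspace Pω S
  nonCompact-≅ = nonCompact↔S ,
    -- By finite interpolation, `D m ⊆ Approx y` holds exactly when a single `b k ≪ y` has all of
    -- `D m` below it.
    ( (λ m k → D m ⊆ (_◁ k))
    , Computable⇒CE (ComputableRel-resp
        (λ { (m ∷ k ∷ []) → mk⇔ (λ f {i} → f {i}) (λ f {i} → f {i}) })
        (D⊆-computable 0F (rename (0F ∷ 2F ∷ []) ◁-computable)))
    , λ m →
        (λ {(y , _)} m⊆ →
          let (k , b≪y , f) = interpolate-finite m {y} (λ {i} → m⊆ {i})
          in k , (λ {i} → f {i}) , b≪y) ,
        (λ {(y , _)} (k , f , b≪y) {i} d →
          approx {y} {i} (≪-≤ₛ-trans space {b i} {b k} {y} (◁⇒≪ (f {i} d)) (≪⇒≤ₛ space {b k} {y} b≪y))) ) ,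
    ( (λ i m → D m i)
    , Computable⇒CE (ComputableRel-resp
        (λ { (i ∷ m ∷ []) → mk⇔ (λ d → d) (λ d → d) })
        (D-computable (lookup-computable 1F) (lookup-computable 0F)))
    , λ i →
        (λ {(I , s)} b≪ →
          let (m , m⊆ , m⊇) = singleton i
          in m , m⊇ {i} refl , λ {x} d → subst I (sym (m⊆ {x} d)) (≪sup⇒∈ s {i} b≪)) ,
        (λ {(I , s)} (m , d , m⊆I) → ∈⇒≪sup s {i} (m⊆I {i} d)) )

theorem11 : (∀ {a} → ExcludedMiddle a) →
    ∀ {c ℓ r} (X : EffectiveSpace c ℓ r) →
    let open EffectiveSpace X using (numberedSpace) in
    (EffectiveQuasiPolish X ⇔
    (Σ[ Y ∈ ComputableAlgebraicDomain (lsuc 0ℓ) 0ℓ ]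
    numberedSpace ≅ ComputableAlgebraicDomain.nonCompact Y)) ×
    (EffectiveQuasiPolish X ⇔
    (Σ[ Y ∈ ComputableDomain (lsuc 0ℓ) 0ℓ ]
    numberedSpace ≅ ComputableDomain.nonCompact Y))
-- Three implications in a cycle give both equivalences.
theorem11 em X = mk⇔ qp⇒alg (cont⇒qp ∘ alg⇒cont) , mk⇔ (alg⇒cont ∘ qp⇒alg) cont⇒qp
  where
  open EffectiveSpace X using (numberedSpace)
  Algebraic Continuous : Set _
  Algebraic = Σ[ Y ∈ ComputableAlgebraicDomain (lsuc 0ℓ) 0ℓ ]
    numberedSpace ≅ ComputableAlgebraicDomain.nonCompact Y
  Continuous = Σ[ Y ∈ ComputableDomain (lsuc 0ℓ) 0ℓ ]
    numberedSpace ≅ ComputableDomain.nonCompact Y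

  qp⇒alg : EffectiveQuasiPolish X → Algebraic
  qp⇒alg (S , S-Π , X≅S) =
    let (Y , S≅Y) = Π⁰₂⇒algebraic em S-Π
    in Y , ≅-trans {X = numberedSpace} {numberedSubspace Pω S}
             {ComputableAlgebraicDomain.nonCompact Y} X≅S S≅Y

  alg⇒cont : Algebraic → Continuous
  alg⇒cont (Y , X≅Y) = continuousDomain , nonCompact-≅ {X = numberedSpace} X≅Y
    where open AlgebraicIsContinuous Y

  cont⇒qp : Continuous → EffectiveQuasiPolish X
  cont⇒qp (Y , X≅Y) = S , S-Π⁰₂ , ≅-trans {X = numberedSpace} {ComputableDomain.nonCompact Y}
      {numberedSubspace Pω S} X≅Y nonCompact-≅
    where open NonCompactIsQuasiPolish em Y
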